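{- Let $P$ be an increasing tableau of normal shape with $C$ columns. Suppose $P^{\searrow}$ is an increasing tableau of anti-normal shape, whose rightmost column is column $C$, obtained from $P$ by anti-rectification (with any choices of where to place the $\bullet$'s). Then the set of entries of column $1$ of $P^{\searrow}$ equals $P_1\triangleleft P_2\triangleleft\cdots\triangleleft P_C$ (evaluated from right to left).
   Context: Tableaux in English convention. An increasing (skew) tableau has positive integer entries strictly increasing along rows and down columns. $P_c$ is the set of entries of column $c$. A skew shape $\lambda/\mu$ is the Young diagram of $\lambda$ minus that of $\mu$; normal shape = Young diagram; anti-normal shape = right- and bottom-justified cells. For finite $T,S\subseteq\mathbb{Z}_{>0}$, $T\triangleleft S$ is computed by going through $s\in S$ from largest to smallest; each $s$ picks the largest not-yet-picked $t\in T$ with $t<s$, if one exists; $T\triangleleft S$ is the set of picked elements. $\triangleleft$ is not associative; iterated expressions are evaluated right to left: $A\triangleleft B\triangleleft C=A\triangleleft(B\triangleleft C)$. A dotted skew tableau fills a skew shape with positive integers and $\bullet$. $\mathrm{sInc}_{m<\bullet}$ = dotted skew tableaux strictly increasing along rows and columns in the order $1<\dots<m<\bullet<m+1<\cdots$. For $m\ge1$, revKjdt $:\mathrm{sInc}_{m<\bullet}\to\mathrm{sInc}_{m-1<\bullet}$ simultaneously replaces every $\bullet$ edge-adjacent to an $m$ by $m$ and every $m$ edge-adjacent to a $\bullet$ by $\bullet$. An anti-rectification step on an increasing skew tableau with entries $\le M$: add $\bullet$'s in some new cells so that the result is an element of $\mathrm{sInc}_{M<\bullet}$ of skew shape, apply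 revKjdt $M$ times, then delete all $\bullet$. Anti-rectification applies such steps repeatedly until the shape is anti-normal. -}

module Defs where

open import Data.Nat using (ℕ; zero; suc; _≤_; _<_; _∸_; _≟_; _<?_)
open import Data.Bool using (Bool; true; false; _∨_; if_then_else_)
open import Data.List using (List; []; _∷_; concatMap; upTo)
open import Data.Maybe using (Maybe; just; nothing)
open import Data.Product using (_×_; ∃; ∃-syntax; _,_)
open import Data.Sum using (_⊎_)
open import Data.Empty using (⊥)
open import Function.Bundles using (_⇔_)
open import Relation.Nullary using (¬_; yes; no)
open import Relation.Binary.PropositionalEquality using (_≡_)

-- Conventions: cells are (row , column), both 0-indexed, rows growing
-- downwards (English convention).  Paper's row i / column j is index
-- i-1 / j-1 here; in particular the paper's column 1 is column index 0.

data Entry : Set where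
  num : ℕ → Entry
  dot : Entry

-- A filling assigns to each cell either nothing (cell not in the shape)
-- or an entry.
Filling : Set
Filling = ℕ → ℕ → Maybe Entry

part : List ℕ → ℕ → ℕ
part []       _       = 0
part (x ∷ _)  zero    = x
part (_ ∷ xs) (suc i) = part xs i

IsPartition : List ℕ → Set
IsPartition lam = ∀ i → part lam (suc i) ≤ part lam i

_⊆ₚ_ : List ℕ → List ℕ → Set
mu ⊆ₚ lam = ∀ i → part mu i ≤ part lam i

InSkew : List ℕ → List ℕ → ℕ → ℕ → Set
InSkew lam mu r c = (part mu r ≤ c) × (c < part lam r)

Occupied : Filling → ℕ → ℕ → Set
Occupied F r c = ∃[ e ] (F r c ≡ just e)

HasShape : Filling → List ℕ → List ℕ → Set
HasShape F lam mu = ∀ r c → InSkew lam mu r c ⇔ Occupied F r c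

IsSkewShaped : Filling → Set
IsSkewShaped F = ∃[ lam ] ∃[ mu ]
  (IsPartition lam × IsPartition mu × (mu ⊆ₚ lam) × HasShape F lam mu)

-- Anti-normal shape: the 180° rotation of a Young diagram nu inside a
-- box with bottom-right cell (R-1 , C-1), i.e. right- and bottom-justified.
AntiCell : ℕ → ℕ → List ℕ → ℕ → ℕ → Set
AntiCell R C nu r c = (r < R) × (c < C) × InSkew nu [] (R ∸ suc r) (C ∸ suc c)

-- anti-normal shape whose rightmost column is column C (paper's
-- numbering; index C-1 here)
IsAntiNormalWidth : ℕ → Filling → Set
IsAntiNormalWidth C F = ∃[ R ] ∃[ nu ]
  (IsPartition nu × (∀ r c → AntiCell R C nu r c ⇔ Occupied F r c))

IsAntiNormal : Filling → Set
IsAntiNormal F = ∃[ C ] IsAntiNormalWidth C F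

LtAt : ℕ → Entry → Entry → Set
LtAt m (num a) (num b) = a < b
LtAt m (num a) dot     = a ≤ m
LtAt m dot     (num b) = m < b
LtAt m dot     dot     = ⊥

IncreasingAt : ℕ → Filling → Set
IncreasingAt m F =
  (∀ r c c' e e' → c < c' → F r c ≡ just e → F r c' ≡ just e' → LtAt m e e')
  × (∀ r r' c e e' → r < r' → F r c ≡ just e → F r' c ≡ just e' → LtAt m e e')

PositiveEntries : Filling → Set
PositiveEntries F = ∀ r c n → F r c ≡ just (num n) → 1 ≤ n

NoDots : Filling → Set
NoDots F = ∀ r c → ¬ (F r c ≡ just dot)

IsIncreasing : Filling → Set
IsIncreasing F = NoDots F × PositiveEntries F × IncreasingAt 0 F

IsIncSkewTableau : Filling → Set
IsIncSkewTableau F = IsSkewShaped F × IsIncreasing F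

IsSInc : ℕ → Filling → Set
IsSInc m F = IsSkewShaped F × PositiveEntries F × IncreasingAt m F

EntriesBoundedBy : ℕ → Filling → Set
EntriesBoundedBy M F = ∀ r c n → F r c ≡ just (num n) → n ≤ M

isNum : ℕ → Maybe Entry → Bool
isNum m (just (num n)) with n ≟ m
... | yes _ = true
... | no _  = false
isNum m _ = false

isDot : Maybe Entry → Bool
isDot (just dot) = true
isDot _          = false

anyNbr : (Maybe Entry → Bool) → Filling → ℕ → ℕ → Bool
anyNbr p F r c = p (F (suc r) c) ∨ p (F r (suc c)) ∨ up r ∨ left c
  where
    up : ℕ → Bool
    up zero     = false
    up (suc r') = p (F r' c)
    left : ℕ → Bool
    left zero     = false
    left (suc c') = p (F r c')

revKjdtCell : ℕ → Filling → ℕ → ℕ → Maybe Entry → Maybe Entry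
revKjdtCell m F r c nothing        = nothing
revKjdtCell m F r c (just dot)     =
  if anyNbr (isNum m) F r c then just (num m) else just dot
revKjdtCell m F r c (just (num n)) with n ≟ m
... | yes _ = if anyNbr isDot F r c then just dot else just (num n)
... | no _  = just (num n)

revKjdt : ℕ → Filling → Filling
revKjdt m F r c = revKjdtCell m F r c (F r c)

revKjdtAll : ℕ → Filling → Filling
revKjdtAll zero    F = F
revKjdtAll (suc m) F = revKjdtAll m (revKjdt (suc m) F)

deleteDots : Filling → Filling
deleteDots F r c with F r c
... | just dot = nothing
... | x        = x

AntiRectStep : Filling → Filling → Set
AntiRectStep T T' = ∃[ M ] ∃[ D ]
  ( IsIncSkewTableau T
  × EntriesBoundedBy M T
  × (∀ r c → (D r c ≡ T r c) ⊎ ((T r c ≡ nothing) × (D r c ≡ just dot)))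
  × IsSInc M D
  × (∀ r c → T' r c ≡ deleteDots (revKjdtAll M D) r c) )

data AntiRect : Filling → Filling → Set where
  done : ∀ {T} → IsAntiNormal T → AntiRect T T
  step : ∀ {T T' U} → ¬ IsAntiNormal T → AntiRectStep T T' → AntiRect T' U
       → AntiRect T U

-- The operation ◁ on finite sets (given as lists without repetition)

insertDesc : ℕ → List ℕ → List ℕ
insertDesc x [] = x ∷ []
insertDesc x (y ∷ ys) with y <? x
... | yes _ = x ∷ y ∷ ys
... | no _  = y ∷ insertDesc x ys

sortDesc : List ℕ → List ℕ
sortDesc []       = []
sortDesc (x ∷ xs) = insertDesc x (sortDesc xs)

pickBelow : ℕ → List ℕ → Maybe ℕ
pickBelow s [] = nothing
pickBelow s (t ∷ ts) with pickBelow s ts | t <? s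
... | nothing | yes _ = just t
... | nothing | no _  = nothing
... | just u  | yes _ with u <? t
...   | yes _ = just t
...   | no _  = just u
pickBelow s (t ∷ ts) | just u | no _ = just u

removeOne : ℕ → List ℕ → List ℕ
removeOne x [] = []
removeOne x (y ∷ ys) with x ≟ y
... | yes _ = ys
... | no _  = y ∷ removeOne x ys

-- ss sorted from largest to smallest; avail = not-yet-picked elements of T
triGo : List ℕ → List ℕ → List ℕ
triGo []       avail = []
triGo (s ∷ ss) avail with pickBelow s avail
... | just t  = t ∷ triGo ss (removeOne t avail)
... | nothing = triGo ss avail

_◁_ : List ℕ → List ℕ → List ℕ
T ◁ S = triGo (sortDesc S) T

◁-iter : List (List ℕ) → List ℕ
◁-iter []           = []
◁-iter (X ∷ [])     = X
◁-iter (X ∷ Y ∷ Xs) = X ◁ ◁-iter (Y ∷ Xs)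

numEntry : Maybe Entry → List ℕ
numEntry (just (num n)) = n ∷ []
numEntry _              = []

colEntries : Filling → ℕ → ℕ → List ℕ
colEntries F R c = concatMap (λ r → numEntry (F r c)) (upTo R)

columnSets : Filling → List ℕ → List (List ℕ)
columnSets P lam = Data.List.map (colEntries P (Data.List.length lam)) (upTo (part lam 0))

{-# OPTIONS --safe #-}
module Submission where

-- For a filling with columns D_0, …, D_k (bullets ignored) put X_k = D_k and
-- X_j = D_j ◁ X_{j+1}.  Then X_0 is invariant under every slide revKjdt m, and in
-- an anti-normal tableau each column is bottom-aligned with the next, so X_0 = D_0.
--
-- T ◁ S is read as one downward sweep over the values that counts the members of
-- S still waiting for a partner.  Comparing, for neighbouring columns, the numbers
-- of rows with entries below a given value bounds this count from both sides.
--
-- A slide changes the set D_j in two ways only.  If D_j loses m, then m has a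
-- bullet to its right and nobody is waiting at m, so m was not picked.  If D_j
-- gains m, then the bullet that becomes m has an m to its left, and X_j may
-- change; but then X_{j-1} is the same again.  The last column loses nothing,
-- because a number that has moved beyond it could never come back.

open import Defs
open import Data.Bool using (Bool; true; false; _∧_; _∨_; T)
open import Data.Bool.Properties using (∧-zeroʳ; ∨-zeroʳ)
open import Data.Empty using (⊥; ⊥-elim)
open import Data.List using (List; []; _∷_; applyUpTo; length; map; upTo)
open import Data.List.Membership.Propositional using (_∈_; _∉_; find; lose)
open import Data.List.Membership.Propositional.Properties using (∈-concatMap⁺; ∈-concatMap⁻; ∈-upTo⁺)
open import Data.List.Relation.Unary.All as All using ([]; _∷_)
import Data.List.Relation.Unary.All.Properties as All
open import Data.List.Relation.Unary.AllPairs as AllPairs using (AllPairs; []; _∷_)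
import Data.List.Relation.Unary.AllPairs.Properties as AllPairs
open import Data.List.Relation.Unary.Any as Any using (here; there)
open import Data.List.Relation.Unary.Unique.Propositional using (Unique)
import Data.List.Relation.Unary.Unique.Propositional.Properties as Unique
open import Data.Maybe using (Maybe; just; nothing)
open import Data.Maybe.Properties using (just-injective)
open import Data.Nat
open import Data.List.Membership.DecPropositional _≟_ using (_∈?_)
open import Data.Nat.Properties hiding (_≟_; _<?_)
open import Algebra.Properties.CommutativeSemigroup +-commutativeSemigroup using (interchange; xy∙z≈xz∙y)
open import Data.Product using (∃-syntax; _×_; _,_; proj₁; proj₂)
open import Data.Sum using (_⊎_; inj₁; inj₂)
open import Data.Unit using (tt)
open import Function using (_∘_)
open import Function.Bundles using (_⇔_; mk⇔; Equivalence)
open import Relation.Binary.Definitions using (tri<; tri≈; tri>)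
open import Relation.Binary.PropositionalEquality
  using (_≡_; _≢_; refl; sym; trans; cong; cong₂; subst; _≗_)
open import Relation.Nullary using (¬_; yes; no; does)
open import Relation.Nullary.Decidable using (dec-true)


-- For j > 0 the sets X_j are not invariant, so an induction over the columns cannot carry an
-- equality alone. It carries the alternative of equality or a gain of the single value m, and a
-- gain remembers the m standing left of the bullet. Column 0 has nothing to its left, so no gain
-- survives there. One changed entry can rearrange many partners in ◁, while the waiting counts
-- before and after differ by at most one. This is why counts replace partners. The upper bound on
-- the count is the number of rows that straddle v: left cell before v, right cell not. Where the
-- bound is attained, every entry of the left column is picked. This makes a gain harmless one
-- column further left, and it also gives X_0 = D_0 in the anti-normal case. Strictness of rows
-- yields the needed inequality at every value except m, where the pair m, • violates it. Hence the
-- sweep is treated separately above and below m, and the row of that pair supplies the comparison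
-- at m itself.

NSet : Set
NSet = ℕ → Bool

[_] : Bool → ℕ
[ true ]  = 1
[ false ] = 0

positive : ℕ → Bool
positive zero    = false
positive (suc _) = true

≡false : ∀ {b} → (b ≡ true → ⊥) → b ≡ false
≡false {false} _ = refl
≡false {true}  n = ⊥-elim (n refl)

false≢true : ∀ {b} → b ≡ false → b ≡ true → ⊥
false≢true refl ()

≡-from-⇔ : ∀ {a b} → (a ≡ true → b ≡ true) → (b ≡ true → a ≡ true) → a ≡ b
≡-from-⇔ {true}  f g = sym (f refl)
≡-from-⇔ {false} {true}  f g = g refl
≡-from-⇔ {false} {false} f g = refl

-- The sweep fixes its counts from large values to small ones, so facts about them are proved
-- downwards from some `N` beyond which they are easy. The floor `m` is there because the hypotheses
-- often hold only above the value being slid.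
descend : (Q : ℕ → Set) (N m : ℕ) → (∀ v → m ≤ v → N ≤ v → Q v) →
          (∀ v → m ≤ v → Q (suc v) → Q v) → ∀ v → m ≤ v → Q v
descend Q N m base next v m≤v = go N v m≤v (m≤n+m N v)
  where
  go : ∀ k v → m ≤ v → N ≤ v + k → Q v
  go zero    v m≤v N≤ = base v m≤v (subst (N ≤_) (+-identityʳ v) N≤)
  go (suc k) v m≤v N≤ =
    next v m≤v (go k (suc v) (m≤n⇒m≤1+n m≤v) (subst (N ≤_) (+-suc v k) N≤))

descendFrom : (Q : ℕ → Set) (m : ℕ) → Q m →
              (∀ v → v < m → Q (suc v) → Q v) → ∀ v → v ≤ m → Q v
descendFrom Q zero    base next .zero z≤n = base
descendFrom Q (suc m) base next v v≤1+m with m≤n⇒m<n∨m≡n v≤1+m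
... | inj₂ refl = base
... | inj₁ (s≤s v≤m) =
  descendFrom Q m (next m ≤-refl base) (λ u u<m → next u (m≤n⇒m≤1+n u<m)) v v≤m

-- Matchings of sets of numbers

-- The greedy rule selects the same set as a downward sweep over the values in
-- which p v counts the elements of S that are ≥ v and still await a partner;
-- a member of T is picked exactly when someone is waiting.
record Match (T S X : NSet) : Set where
  constructor match
  field
    p     : ℕ → ℕ
    top   : ℕ
    idle  : ∀ v → top ≤ v → p v ≡ 0
    sweep : ∀ v → p v ≡ (p (suc v) ∸ [ T v ]) + [ S v ]
    out   : ∀ v → X v ≡ T v ∧ positive (p (suc v))

module _ {T S X : NSet} (M : Match T S X) where
  open Match M

  Match-⊆ : ∀ v → X v ≡ true → T v ≡ true
  Match-⊆ v Xv rewrite out v with T v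
  ... | true  = refl

  p-agree-above : ∀ {T′ S′ X′} (M′ : Match T′ S′ X′) m →
    (∀ v → m ≤ v → T v ≡ T′ v) → (∀ v → m ≤ v → S v ≡ S′ v) →
    ∀ v → m ≤ v → p v ≡ Match.p M′ v
  p-agree-above M′ m eT eS = descend (λ v → p v ≡ p′ v) (top ⊔ M′.top) m
      (λ v _ t≤v → trans (idle v (≤-trans (m≤m⊔n _ _) t≤v))
                       (sym (M′.idle v (≤-trans (m≤n⊔m _ _) t≤v))))
      (λ v m≤v IH → trans (sweep v) (trans
         (cong₂ _+_ (cong₂ _∸_ IH (cong [_] (eT v m≤v))) (cong [_] (eS v m≤v)))
         (sym (M′.sweep v))))
    where
    module M′ = Match M′
    p′ = M′.p

  p-agree-below : ∀ {T′ S′ X′} (M′ : Match T′ S′ X′) m → p m ≡ Match.p M′ m →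
    (∀ v → v < m → T v ≡ T′ v) → (∀ v → v < m → S v ≡ S′ v) →
    ∀ v → v ≤ m → p v ≡ Match.p M′ v
  p-agree-below M′ m e eT eS = descendFrom (λ v → p v ≡ Match.p M′ v) m e
      (λ v v<m IH → trans (sweep v) (trans
         (cong₂ _+_ (cong₂ _∸_ IH (cong [_] (eT v v<m))) (cong [_] (eS v v<m)))
         (sym (Match.sweep M′ v))))

  out-agree : ∀ {T′ S′ X′} (M′ : Match T′ S′ X′) v → T v ≡ T′ v →
    p (suc v) ≡ Match.p M′ (suc v) → X v ≡ X′ v
  out-agree M′ v eT ep =
    trans (out v) (trans (cong₂ (λ t q → t ∧ positive q) eT ep) (sym (Match.out M′ v)))

  Match-unique : ∀ {T′ S′ X′} → Match T′ S′ X′ → T ≗ T′ → S ≗ S′ → X ≗ X′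
  Match-unique M′ eT eS v = out-agree M′ v (eT v)
    (p-agree-above M′ 0 (λ u _ → eT u) (λ u _ → eS u) (suc v) z≤n)

Match-cong : ∀ {T T′ S S′ X X′} → T ≗ T′ → S ≗ S′ → X ≗ X′ → Match T S X → Match T′ S′ X′
Match-cong {T} {T′} {S} {S′} eT eS eX (match p top ab sw out) = match p top ab
  (λ v → trans (sw v) (cong₂ (λ t s → (p (suc v) ∸ [ t ]) + [ s ]) (eT v) (eS v)))
  (λ v → trans (sym (eX v)) (trans (out v) (cong (_∧ positive (p (suc v))) (eT v))))

-- The count at `v` comes from the count at `suc v`, which is no structural recursion. Fuel replaces
-- it: nothing is pending from `N` on, so `N` rounds already reach the stable value.
Match-exists : ∀ T S N → (∀ v → N ≤ v → S v ≡ false) → ∃[ X ] Match T S X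
Match-exists T S N S-bounded = _ , match (pend N) N pend-above pend-sweep (λ _ → refl)
  where
  pend : ℕ → ℕ → ℕ
  pend zero    v = 0
  pend (suc k) v = (pend k (suc v) ∸ [ T v ]) + [ S v ]

  pend-above-k : ∀ k v → N ≤ v → pend k v ≡ 0
  pend-above-k zero    v N≤v = refl
  pend-above-k (suc k) v N≤v
    rewrite pend-above-k k (suc v) (m≤n⇒m≤1+n N≤v) | S-bounded v N≤v | 0∸n≡0 [ T v ] = refl

  pend-above : ∀ v → N ≤ v → pend N v ≡ 0
  pend-above = pend-above-k N

  stable : ∀ k v → N ≤ v + k → pend (suc k) v ≡ pend k v
  stable zero v N≤ = pend-above-k 1 v (subst (N ≤_) (+-identityʳ v) N≤)
  stable (suc k) v N≤ = cong (λ q → (q ∸ [ T v ]) + [ S v ])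
    (stable k (suc v) (subst (N ≤_) (+-suc v k) N≤))

  pend-sweep : ∀ v → pend N v ≡ (pend N (suc v) ∸ [ T v ]) + [ S v ]
  pend-sweep v = sym (stable N v (m≤n+m N v))

-- Bounds on the pending count

-- A and B are the row counts of two neighbouring columns: A v is the number of
-- rows in which the left column has an entry < v or lies before the shape.
module _ {T S X : NSet} (M : Match T S X) (A B : ℕ → ℕ) where
  open Match M

  -- If the entry at `v` exhausts the queue, only a new request can remain, and `B (suc v) ≤ A v`
  -- makes room for it. Otherwise the subtraction is exact and the bound passes from `suc v` to `v`.
  pending-bounded : ∀ m →
    (∀ v → m ≤ v → A (suc v) ≤ A v + [ T v ]) →
    (∀ v → m ≤ v → B v + [ S v ] ≤ B (suc v)) →
    (∀ v → m ≤ v → B (suc v) ≤ A v) →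
    (∀ v → m ≤ v → p v + B v ≤ A v)
  pending-bounded m A-step B-step B≤A = descend _ top m base next
    where
    open ≤-Reasoning
    base : ∀ v → m ≤ v → top ≤ v → p v + B v ≤ A v
    base v m≤v t≤v rewrite idle v t≤v =
      ≤-trans (m≤m+n (B v) _) (≤-trans (B-step v m≤v) (B≤A v m≤v))

    step-bound : ∀ q t s a b a′ b′ → q + b′ ≤ a′ → a′ ≤ a + t → b + s ≤ b′ → b′ ≤ a →
                 ((q ∸ t) + s) + b ≤ a
    step-bound q t s a b a′ b′ q≤ a≤ b≤ b′≤a with ≤-total q t
    ... | inj₁ q≤t rewrite m≤n⇒m∸n≡0 q≤t = begin
      s + b ≡⟨ +-comm s b ⟩
      b + s ≤⟨ b≤ ⟩
      b′    ≤⟨ b′≤a ⟩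
      a     ∎
    ... | inj₂ t≤q = +-cancelʳ-≤ t _ _ (begin
      ((q ∸ t) + s) + b + t ≡⟨ +-assoc ((q ∸ t) + s) b t ⟩
      ((q ∸ t) + s) + (b + t) ≡⟨ +-assoc (q ∸ t) s (b + t) ⟩
      (q ∸ t) + (s + (b + t)) ≡⟨ cong (q ∸ t +_) (trans (sym (+-assoc s b t))
                                   (trans (+-comm (s + b) t) (cong (t +_) (+-comm s b)))) ⟩
      (q ∸ t) + (t + (b + s)) ≡⟨ sym (+-assoc (q ∸ t) t (b + s)) ⟩
      (q ∸ t) + t + (b + s) ≡⟨ cong (_+ (b + s)) (m∸n+n≡m t≤q) ⟩
      q + (b + s) ≤⟨ +-monoʳ-≤ q b≤ ⟩
      q + b′ ≤⟨ q≤ ⟩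
      a′ ≤⟨ a≤ ⟩
      a + t ∎)

    next : ∀ v → m ≤ v → p (suc v) + B (suc v) ≤ A (suc v) → p v + B v ≤ A v
    next v m≤v IH rewrite sweep v =
      step-bound (p (suc v)) [ T v ] [ S v ] (A v) (B v) (A (suc v)) (B (suc v))
        IH (A-step v m≤v) (B-step v m≤v) (B≤A v m≤v)

  -- The reverse bound `A ≤ p + B`, saturation, forces picks: with nobody waiting, an entry `v` of
  -- `T` would give `A v + 1 ≤ A (suc v) ≤ B (suc v) ≤ A v`.
  pending-positive : ∀ v → A v + [ T v ] ≤ A (suc v) → B (suc v) ≤ A v →
    A (suc v) ≤ p (suc v) + B (suc v) → T v ≡ true → positive (p (suc v)) ≡ true
  pending-positive v A-step B≤A sat Tv with p (suc v)
  ... | suc _ = refl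
  ... | zero rewrite Tv =
    ⊥-elim (1+n≰n (≤-trans (≤-reflexive (+-comm 1 (A v))) (≤-trans A-step (≤-trans sat B≤A))))

  -- For row counts, saturation is inherited downwards as long as `S` contains the entries of the
  -- right column. Truncated subtraction does no harm here, because it can only leave `p` larger.
  pending-saturated : ∀ v → A v + [ T v ] ≤ A (suc v) → B (suc v) ≤ B v + [ S v ] →
    A (suc v) ≤ p (suc v) + B (suc v) → A v ≤ p v + B v
  pending-saturated v A-step B-step sat rewrite sweep v = +-cancelʳ-≤ [ T v ] _ _ (begin
      A v + [ T v ] ≤⟨ A-step ⟩
      A (suc v) ≤⟨ sat ⟩
      q + B (suc v) ≤⟨ +-monoʳ-≤ q B-step ⟩
      q + (B v + s) ≤⟨ +-monoˡ-≤ (B v + s) (m≤n+m∸n q t) ⟩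
      t + (q ∸ t) + (B v + s) ≡⟨ +-assoc t (q ∸ t) (B v + s) ⟩
      t + ((q ∸ t) + (B v + s)) ≡⟨ +-comm t _ ⟩
      (q ∸ t) + (B v + s) + t ≡⟨ cong (λ z → (q ∸ t) + z + t) (+-comm (B v) s) ⟩
      (q ∸ t) + (s + B v) + t ≡⟨ cong (_+ t) (sym (+-assoc (q ∸ t) s (B v))) ⟩
      (q ∸ t) + s + B v + t ∎)
    where
    open ≤-Reasoning
    q = p (suc v)
    t = [ T v ]
    s = [ S v ]

-- Matchings that differ in one element

-- The arguments are: whether the sweep is inside the zone before and after the
-- value, and whether the value lies in the column, in X and in X′.
data ZoneStep : Bool → Bool → Bool → Bool → Bool → Set where
  stay    : ∀ {d} → ZoneStep true true d d d
  exit    : ZoneStep true false true true false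
  outside : ∀ {d x} → ZoneStep false false d x x

-- X′ arises from X by a new element m that either comes for free or pushes out
-- one y < m.  In the zone, i.e. between m and y (or anywhere below m if there is
-- no y), all of D is selected.
record Gain (m : ℕ) (D X X′ : NSet) : Set where
  field
    same-above : ∀ v → m < v → X v ≡ X′ v
    lacks      : X m ≡ false
    has        : X′ m ≡ true
    zone       : NSet
    zone-start : zone m ≡ true
    zone-step  : ∀ v → v < m → ZoneStep (zone (suc v)) (zone v) (D v) (X v) (X′ v)

module _ {m : ℕ} {T T′ S S′ X X′ : NSet} (M : Match T S X) (M′ : Match T′ S′ X′)
         (T≐T′ : ∀ v → v ≢ m → T v ≡ T′ v) where
  private
    module M = Match M
    module M′ = Match M′

    T-above : ∀ v → suc m ≤ v → T v ≡ T′ v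
    T-above v m<v = T≐T′ v (λ { refl → 1+n≰n m<v })

    T-below : ∀ v → v < m → T v ≡ T′ v
    T-below v v<m = T≐T′ v (λ { refl → 1+n≰n v<m })

  Match-transfer : (∀ v → m < v → M.p v ≡ M′.p v) → X m ≡ X′ m →
    (∀ v → v < m → X v ≡ X′ v) → X ≗ X′
  Match-transfer above at below v with <-cmp v m
  ... | tri< v<m _ _ = below v v<m
  ... | tri≈ _ refl _ = at
  ... | tri> _ _ m<v = out-agree M M′ v (T-above v m<v) (above (suc v) (m≤n⇒m≤1+n m<v))

  Match-lose : T′ m ≡ false → M.p (suc m) ≡ 0 → S ≗ S′ → X ≗ X′
  Match-lose T′m p≡0 S≐S′ = Match-transfer above at
      (λ v v<m → out-agree M M′ v (T-below v v<m) (below (suc v) v<m))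
    where
    above : ∀ v → m < v → M.p v ≡ M′.p v
    above = p-agree-above M M′ (suc m) T-above (λ v _ → S≐S′ v)
    p′≡0 : M′.p (suc m) ≡ 0
    p′≡0 = trans (sym (above (suc m) ≤-refl)) p≡0
    at : X m ≡ X′ m
    at rewrite M.out m | M′.out m | p≡0 | p′≡0 | T′m with T m
    ... | true  = refl
    ... | false = refl
    at-p : M.p m ≡ M′.p m
    at-p rewrite M.sweep m | M′.sweep m | p≡0 | p′≡0 | 0∸n≡0 [ T m ] | 0∸n≡0 [ T′ m ] =
      cong [_] (S≐S′ m)
    below : ∀ v → v ≤ m → M.p v ≡ M′.p v
    below = p-agree-below M M′ m at-p T-below (λ v _ → S≐S′ v)

  -- If someone waits at `m`, the new entry serves one request, so below `m` the sweep of `M` has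
  -- one request more than that of `M′`. Both pick the same entries until `M` serves its last
  -- request with a `y` for which nobody waits in `M′`; after that the counts agree. The zone is
  -- where the surplus lasts.
  Match-gain : T m ≡ false → T′ m ≡ true → S ≗ S′ → X ≗ X′ ⊎ Gain m T X X′
  Match-gain Tm T′m S≐S′ = by-pending (M.p (suc m)) refl
    where
    above : ∀ v → m < v → M.p v ≡ M′.p v
    above = p-agree-above M M′ (suc m) T-above (λ v _ → S≐S′ v)
    Xm : X m ≡ false
    Xm rewrite M.out m | Tm = refl

    Close : ℕ → ℕ → Set
    Close q q′ = q ≡ q′ ⊎ q ≡ suc q′

    zone : NSet
    zone v = positive (M.p v ∸ M′.p v)

    move : ∀ q q′ t s → Close q q′ →
      Close ((q ∸ [ t ]) + [ s ]) ((q′ ∸ [ t ]) + [ s ]) ×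
      ZoneStep (positive (q ∸ q′)) (positive (((q ∸ [ t ]) + [ s ]) ∸ ((q′ ∸ [ t ]) + [ s ])))
               t (t ∧ positive q) (t ∧ positive q′)
    move q .q t s (inj₁ refl) rewrite n∸n≡0 q | n∸n≡0 ((q ∸ [ t ]) + [ s ]) = inj₁ refl , outside
    move .(suc q) q false s (inj₂ refl)
      rewrite m+n∸n≡m 1 q | m+n∸n≡m 1 (q + [ s ]) = inj₂ refl , stay
    move .1 zero true s (inj₂ refl) rewrite n∸n≡0 [ s ] = inj₁ refl , exit
    move .(suc (suc q)) (suc q) true s (inj₂ refl)
      rewrite m+n∸n≡m 1 q | m+n∸n≡m 1 (q + [ s ]) = inj₂ refl , stay

    by-pending : ∀ q → M.p (suc m) ≡ q → X ≗ X′ ⊎ Gain m T X X′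
    by-pending zero p≡0 = inj₁ (Match-transfer above at
        (λ v v<m → out-agree M M′ v (T-below v v<m) (below (suc v) v<m)))
      where
      p′≡0 : M′.p (suc m) ≡ 0
      p′≡0 = trans (sym (above (suc m) ≤-refl)) p≡0
      at : X m ≡ X′ m
      at rewrite M.out m | M′.out m | p′≡0 | Tm | T′m = refl
      at-p : M.p m ≡ M′.p m
      at-p rewrite M.sweep m | M′.sweep m | p≡0 | p′≡0 | Tm | T′m = cong [_] (S≐S′ m)
      below : ∀ v → v ≤ m → M.p v ≡ M′.p v
      below = p-agree-below M M′ m at-p T-below (λ v _ → S≐S′ v)
    by-pending (suc q) p≡ = inj₂ (record
      { same-above = λ v m<v → out-agree M M′ v (T-above v m<v) (above (suc v) (m≤n⇒m≤1+n m<v))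
      ; lacks = Xm
      ; has = has
      ; zone = zone
      ; zone-start = start
      ; zone-step = zone-step })
      where
      p′≡ : M′.p (suc m) ≡ suc q
      p′≡ = trans (sym (above (suc m) ≤-refl)) p≡
      has : X′ m ≡ true
      has rewrite M′.out m | p′≡ | T′m = refl
      apart : M.p m ≡ suc (M′.p m)
      apart rewrite M.sweep m | M′.sweep m | p≡ | p′≡ | Tm | T′m | S≐S′ m = refl
      start : zone m ≡ true
      start rewrite apart | m+n∸n≡m 1 (M′.p m) = refl
      close : ∀ v → v ≤ m → Close (M.p v) (M′.p v)
      close = descendFrom _ m (inj₂ apart) next
        where
        next : ∀ v → v < m → Close (M.p (suc v)) (M′.p (suc v)) → Close (M.p v) (M′.p v)
        next v v<m c rewrite M.sweep v | M′.sweep v | sym (T-below v v<m) | sym (S≐S′ v) =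
          proj₁ (move _ _ (T v) (S v) c)
      zone-step : ∀ v → v < m → ZoneStep (zone (suc v)) (zone v) (T v) (X v) (X′ v)
      zone-step v v<m
        rewrite M.out v | M′.out v | M.sweep v | M′.sweep v | sym (T-below v v<m) | sym (S≐S′ v) =
        proj₂ (move _ _ (T v) (S v) (close (suc v) v<m))

  -- A gain in the right column is absorbed: the new member m of S′ is served by
  -- the m of the left column or leaves one more request pending than S does, and
  -- inside the zone every entry of the left column is requested anyway.
  Match-absorb : ∀ {D} (A B : ℕ → ℕ) → Gain m D S S′ → T m ≡ true →
    M.p (suc m) ≤ [ T′ m ] →
    (∀ v → v < m → A v + [ T v ] ≤ A (suc v)) →
    (∀ v → v < m → B (suc v) ≤ B v + [ D v ]) →
    (∀ v → v < m → B (suc v) ≤ A v) →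
    A m ≤ B m → X ≗ X′
  Match-absorb {D} A B G Tm p≤ A-step B-step B≤A A≤B = Match-transfer above at
      (λ v v<m → out-below v v<m (invariant (suc v) v<m))
    where
    open Gain G
    above : ∀ v → m < v → M.p v ≡ M′.p v
    above = p-agree-above M M′ (suc m) T-above same-above
    p′≡p : M′.p (suc m) ≡ M.p (suc m)
    p′≡p = sym (above (suc m) ≤-refl)

    served : ∀ q t → q ≤ [ t ] → positive q ≡ t ∧ positive q
    served _       true  _ = refl
    served .zero   false z≤n = refl

    at : X m ≡ X′ m
    at rewrite M.out m | M′.out m | p′≡p | Tm = served _ (T′ m) p≤

    -- An entry of `T` met in the zone while nobody waits in `M` would swallow the surplus request
    -- and be picked in `M′` only. The saturation in the second component excludes this.
    Inv : ℕ → Set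
    Inv v = M′.p v ≡ M.p v + [ zone v ] × (zone v ≡ true → A v ≤ M.p v + B v)

    start : ∀ q t → q ≤ [ t ] → (q ∸ [ t ]) + 1 ≡ ((q ∸ 1) + 0) + 1
    start zero    true  _ = refl
    start zero    false _ = refl
    start (suc zero) true _ = refl
    start (suc (suc q)) true (s≤s ())

    Inv-m : Inv m
    Inv-m rewrite M.sweep m | M′.sweep m | p′≡p | zone-start | Tm | lacks | has =
      start _ (T′ m) p≤ , λ _ → ≤-trans A≤B (m≤n+m (B m) _)

    move : ∀ {z z′ d s s′} → ZoneStep z z′ d s s′ → ∀ q t →
      (z ≡ true → t ≡ true → positive q ≡ true) →
      ((q + [ z ]) ∸ [ t ]) + [ s′ ] ≡ ((q ∸ [ t ]) + [ s ]) + [ z′ ]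
    move (stay {d}) q false _ = xy∙z≈xz∙y q 1 [ d ]
    move stay zero true pos with pos refl refl
    ... | ()
    move (stay {d}) (suc q) true _ = xy∙z≈xz∙y q 1 [ d ]
    move exit q false _ = refl
    move exit zero true pos with pos refl refl
    ... | ()
    move exit (suc q) true _ = refl
    move (outside {d} {x}) q t _ rewrite +-identityʳ q | +-identityʳ ((q ∸ [ t ]) + [ x ]) = refl

    backward : ∀ {z z′ d s s′} → ZoneStep z z′ d s s′ → z′ ≡ true → z ≡ true × s ≡ d
    backward stay _ = refl , refl

    pos : ∀ v → v < m → Inv (suc v) → zone (suc v) ≡ true → T v ≡ true → positive (M.p (suc v)) ≡ true
    pos v v<m (_ , sat) z = pending-positive M A B v (A-step v v<m) (B≤A v v<m) (sat z)

    next : ∀ v → v < m → Inv (suc v) → Inv v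
    next v v<m I@(e , sat) = e′ , sat′
      where
      e′ : M′.p v ≡ M.p v + [ zone v ]
      e′ rewrite M.sweep v | M′.sweep v | e | sym (T-below v v<m) =
        move (zone-step v v<m) (M.p (suc v)) (T v) (pos v v<m I)
      sat′ : zone v ≡ true → A v ≤ M.p v + B v
      sat′ z with backward (zone-step v v<m) z
      ... | z⁺ , Sv≡Dv = pending-saturated M A B v (A-step v v<m)
              (subst (λ d → B (suc v) ≤ B v + [ d ]) (sym Sv≡Dv) (B-step v v<m)) (sat z⁺)

    invariant : ∀ v → v ≤ m → Inv v
    invariant = descendFrom Inv m Inv-m next

    same-positive : ∀ q z t → (z ≡ true → t ≡ true → positive q ≡ true) →
      t ∧ positive q ≡ t ∧ positive (q + [ z ])
    same-positive q       z     false _ = refl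
    same-positive (suc q) z     true  _ = refl
    same-positive zero    false true  _ = refl
    same-positive zero    true  true  pos = pos refl refl

    out-below : ∀ v → v < m → Inv (suc v) → X v ≡ X′ v
    out-below v v<m I@(e , _) rewrite M.out v | M′.out v | e | sym (T-below v v<m) =
      same-positive _ (zone (suc v)) (T v) (pos v v<m I)

-- The slide on fillings

isNum-self : ∀ n → isNum n (just (num n)) ≡ true
isNum-self n with n ≟ n
... | yes _  = refl
... | no n≢n = ⊥-elim (n≢n refl)

isNum-true : ∀ n x → isNum n x ≡ true → x ≡ just (num n)
isNum-true n (just (num k)) e with k ≟ n
... | yes refl = refl

isNum-intro : ∀ n {x} → x ≡ just (num n) → isNum n x ≡ true
isNum-intro n refl = isNum-self n

isDot-true : ∀ x → isDot x ≡ true → x ≡ just dot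
isDot-true (just dot) e = refl

isDot-intro : ∀ {x} → x ≡ just dot → isDot x ≡ true
isDot-intro refl = refl

data Neighbour (Q : ℕ → ℕ → Set) : ℕ → ℕ → Set where
  below : ∀ {r c} → Q (suc r) c → Neighbour Q r c
  right : ∀ {r c} → Q r (suc c) → Neighbour Q r c
  above : ∀ {r c} → Q r c → Neighbour Q (suc r) c
  left  : ∀ {r c} → Q r c → Neighbour Q r (suc c)

module _ (p : Maybe Entry → Bool) (F : Filling) where
  anyNbr-true : ∀ r c → anyNbr p F r c ≡ true → Neighbour (λ i j → p (F i j) ≡ true) r c
  anyNbr-true r c e with p (F (suc r) c) in eq
  ... | true = below eq
  anyNbr-true r c e | false with p (F r (suc c)) in eq′
  ... | true = right eq′
  anyNbr-true (suc r) c e | false | false with p (F r c) in eq″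
  ... | true = above eq″
  anyNbr-true (suc r) (suc c) e | false | false | false = left e
  anyNbr-true zero (suc c) e | false | false = left e

  anyNbr-intro : ∀ {r c} → Neighbour (λ i j → p (F i j) ≡ true) r c → anyNbr p F r c ≡ true
  anyNbr-intro (below e) rewrite e = refl
  anyNbr-intro {r} {c} (right e) rewrite e = ∨-zeroʳ (p (F (suc r) c))
  anyNbr-intro {suc r} {c} (above e)
    rewrite e | ∨-zeroʳ (p (F (suc r) (suc c))) = ∨-zeroʳ (p (F (suc (suc r)) c))
  anyNbr-intro {zero} {suc c} (left e)
    rewrite e | ∨-zeroʳ (p (F 0 (suc (suc c)))) = ∨-zeroʳ (p (F 1 (suc c)))
  anyNbr-intro {suc r} {suc c} (left e)
    rewrite e | ∨-zeroʳ (p (F r (suc c))) | ∨-zeroʳ (p (F (suc r) (suc (suc c)))) =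
    ∨-zeroʳ (p (F (suc (suc r)) (suc c)))

Neighbour-map : ∀ {Q Q′ : ℕ → ℕ → Set} → (∀ i j → Q i j → Q′ i j) →
  ∀ {r c} → Neighbour Q r c → Neighbour Q′ r c
Neighbour-map f (below q) = below (f _ _ q)
Neighbour-map f (right q) = right (f _ _ q)
Neighbour-map f (above q) = above (f _ _ q)
Neighbour-map f (left q)  = left (f _ _ q)

module _ (m : ℕ) (F : Filling) where
  NumNbr DotNbr : ℕ → ℕ → Set
  NumNbr = Neighbour (λ i j → F i j ≡ just (num m))
  DotNbr = Neighbour (λ i j → F i j ≡ just dot)

  revKjdt-nothing : ∀ {r c} → F r c ≡ nothing → revKjdt m F r c ≡ nothing
  revKjdt-nothing e rewrite e = refl

  revKjdt-other : ∀ {r c n} → n ≢ m → F r c ≡ just (num n) → revKjdt m F r c ≡ just (num n)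
  revKjdt-other {n = n} n≢m e rewrite e with n ≟ m
  ... | yes n≡m = ⊥-elim (n≢m n≡m)
  ... | no _    = refl

  revKjdt-num : ∀ {r c} → F r c ≡ just (num m) →
    (DotNbr r c × revKjdt m F r c ≡ just dot) ⊎
    (¬ DotNbr r c × revKjdt m F r c ≡ just (num m))
  revKjdt-num {r} {c} e rewrite e with m ≟ m
  ... | no m≢m = ⊥-elim (m≢m refl)
  ... | yes _ with anyNbr isDot F r c in eq
  ...   | true  = inj₁ (Neighbour-map (λ i j → isDot-true (F i j)) (anyNbr-true isDot F r c eq) , refl)
  ...   | false = inj₂ ((λ nb → false≢true eq (anyNbr-intro isDot F
                    (Neighbour-map (λ i j → isDot-intro) nb))) , refl)

  revKjdt-dot : ∀ {r c} → F r c ≡ just dot →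
    (NumNbr r c × revKjdt m F r c ≡ just (num m)) ⊎
    (¬ NumNbr r c × revKjdt m F r c ≡ just dot)
  revKjdt-dot {r} {c} e rewrite e with anyNbr (isNum m) F r c in eq
  ... | true  = inj₁ (Neighbour-map (λ i j → isNum-true m (F i j)) (anyNbr-true (isNum m) F r c eq) , refl)
  ... | false = inj₂ ((λ nb → false≢true eq (anyNbr-intro (isNum m) F
                  (Neighbour-map (λ i j → isNum-intro m) nb))) , refl)

  revKjdt-num-swaps : ∀ {r c} → F r c ≡ just (num m) → DotNbr r c → revKjdt m F r c ≡ just dot
  revKjdt-num-swaps e nb with revKjdt-num e
  ... | inj₁ (_ , e′)   = e′
  ... | inj₂ (¬nb , _) = ⊥-elim (¬nb nb)

  revKjdt-dot-swaps : ∀ {r c} → F r c ≡ just dot → NumNbr r c → revKjdt m F r c ≡ just (num m)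
  revKjdt-dot-swaps e nb with revKjdt-dot e
  ... | inj₁ (_ , e′)   = e′
  ... | inj₂ (¬nb , _) = ⊥-elim (¬nb nb)

  data Change : Entry → Entry → Set where
    fixed : ∀ {n} → n ≢ m → Change (num n) (num n)
    stays : Change (num m) (num m)
    moves : Change (num m) dot
    fills : Change dot (num m)
    waits : Change dot dot

  revKjdt-change : ∀ {r c x′} → revKjdt m F r c ≡ just x′ → ∃[ x ] (F r c ≡ just x × Change x x′)
  revKjdt-change {r} {c} {x′} e′ = by-entry (F r c) refl
    where
    retarget : ∀ {x y} → Change x y → revKjdt m F r c ≡ just y → Change x x′
    retarget ch e = subst (Change _) (just-injective (trans (sym e) e′)) ch
    by-entry : ∀ x → F r c ≡ x → ∃[ x ] (F r c ≡ just x × Change x x′)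
    by-entry nothing e with trans (sym (revKjdt-nothing e)) e′
    ... | ()
    by-entry (just dot) e with revKjdt-dot e
    ... | inj₁ (_ , e″) = dot , e , retarget fills e″
    ... | inj₂ (_ , e″) = dot , e , retarget waits e″
    by-entry (just (num n)) e with n ≟ m
    ... | no n≢m = num n , e , retarget (fixed n≢m) (revKjdt-other n≢m e)
    ... | yes refl with revKjdt-num e
    ...   | inj₁ (_ , e″) = num n , e , retarget moves e″
    ...   | inj₂ (_ , e″) = num n , e , retarget stays e″

  revKjdt-occupied : ∀ {r c x} → F r c ≡ just x → ∃[ x′ ] (revKjdt m F r c ≡ just x′)
  revKjdt-occupied {x = dot} e with revKjdt-dot e
  ... | inj₁ (_ , e′) = _ , e′
  ... | inj₂ (_ , e′) = _ , e′
  revKjdt-occupied {x = num n} e with n ≟ m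
  ... | no n≢m = _ , revKjdt-other n≢m e
  ... | yes refl with revKjdt-num e
  ...   | inj₁ (_ , e′) = _ , e′
  ...   | inj₂ (_ , e′) = _ , e′

-- The slide preserves increasing dotted tableaux

part-antitone : ∀ lam → IsPartition lam → ∀ {i j} → i ≤ j → part lam j ≤ part lam i
part-antitone lam P {i} {j} i≤j = subst (λ k → part lam k ≤ part lam i) (m∸n+n≡m i≤j) (go (j ∸ i))
  where
  go : ∀ k → part lam (k + i) ≤ part lam i
  go zero    = ≤-refl
  go (suc k) = ≤-trans (P (k + i)) (go k)

revKjdt-shape : ∀ m F lam mu → HasShape F lam mu → HasShape (revKjdt m F) lam mu
revKjdt-shape m F lam mu sh r c = mk⇔
  (λ ins → revKjdt-occupied m F (proj₂ (Equivalence.to (sh r c) ins)))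
  (λ { (_ , e) → let (x , e′ , _) = revKjdt-change m F e in Equivalence.from (sh r c) (x , e′) })

-- The old and the new order differ only in how `suc m` compares with a bullet. So the one critical
-- pair is `suc m` before a bullet, and `swap` is the geometric input that both cells then change.
LtAt-change : ∀ m F {x y x′ y′} → Change (suc m) F x x′ → Change (suc m) F y y′ →
  LtAt (suc m) x y → (x ≡ num (suc m) → y ≡ dot → x′ ≡ dot × y′ ≡ num (suc m)) → LtAt m x′ y′
LtAt-change m F (fixed _) (fixed _) lt swap = lt
LtAt-change m F (fixed _) stays lt swap = lt
LtAt-change m F (fixed _) moves lt swap = ≤-pred lt
LtAt-change m F (fixed n≢m) fills lt swap = ≤∧≢⇒< lt n≢m
LtAt-change m F (fixed n≢m) waits lt swap = ≤-pred (≤∧≢⇒< lt n≢m)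
LtAt-change m F stays (fixed _) lt swap = lt
LtAt-change m F moves (fixed _) lt swap = ≤-trans (n≤1+n _) lt
LtAt-change m F fills (fixed _) lt swap = lt
LtAt-change m F waits (fixed _) lt swap = ≤-trans (n≤1+n _) lt
LtAt-change m F stays stays lt swap = ⊥-elim (1+n≰n lt)
LtAt-change m F stays moves lt swap = ⊥-elim (1+n≰n lt)
LtAt-change m F moves stays lt swap = ⊥-elim (1+n≰n lt)
LtAt-change m F moves moves lt swap = ⊥-elim (1+n≰n lt)
LtAt-change m F fills stays lt swap = ⊥-elim (1+n≰n lt)
LtAt-change m F fills moves lt swap = ⊥-elim (1+n≰n lt)
LtAt-change m F waits stays lt swap = ⊥-elim (1+n≰n lt)
LtAt-change m F waits moves lt swap = ⊥-elim (1+n≰n lt)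
LtAt-change m F stays fills lt swap with swap refl refl
... | () , _
LtAt-change m F stays waits lt swap with swap refl refl
... | () , _
LtAt-change m F moves fills lt swap = ≤-refl
LtAt-change m F moves waits lt swap with swap refl refl
... | _ , ()

-- The bullet is the immediate successor of `m`. Since rows and columns of a skew shape have no
-- holes, an `m` and a later bullet in one line are therefore edge-adjacent and get exchanged.
LtAt-gap : ∀ m e → LtAt m (num m) e → LtAt m e dot → ⊥
LtAt-gap m (num k) m<k k≤m = 1+n≰n (≤-trans m<k k≤m)

module SIncLemmas {m : ℕ} {F : Filling} (S : IsSInc m F) where
  lam mu : List ℕ
  lam = proj₁ (proj₁ S)
  mu  = proj₁ (proj₂ (proj₁ S))

  lam-partition : IsPartition lam
  lam-partition = proj₁ (proj₂ (proj₂ (proj₁ S)))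
  mu-partition : IsPartition mu
  mu-partition = proj₁ (proj₂ (proj₂ (proj₂ (proj₁ S))))
  shape : HasShape F lam mu
  shape = proj₂ (proj₂ (proj₂ (proj₂ (proj₂ (proj₁ S)))))
  row-increasing = proj₁ (proj₂ (proj₂ S))
  column-increasing = proj₂ (proj₂ (proj₂ S))

  inside : ∀ {r c e} → F r c ≡ just e → InSkew lam mu r c
  inside {r} {c} eq = Equivalence.from (shape r c) (_ , eq)

  entry : ∀ {r c} → part mu r ≤ c → c < part lam r → ∃[ e ] (F r c ≡ just e)
  entry {r} {c} l u = Equivalence.to (shape r c) (l , u)

  row-adjacent : ∀ {r c c′} → c < c′ → F r c ≡ just (num m) → F r c′ ≡ just dot → c′ ≡ suc c
  row-adjacent {r} {c} {c′} c<c′ e e′ with m≤n⇒m<n∨m≡n c<c′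
  ... | inj₂ eq = sym eq
  ... | inj₁ c+1<c′ with entry {r} {suc c} (m≤n⇒m≤1+n (proj₁ (inside e))) (<-trans c+1<c′ (proj₂ (inside e′)))
  ...   | x , ex = ⊥-elim (LtAt-gap m x (row-increasing r c (suc c) _ _ ≤-refl e ex)
                                       (row-increasing r (suc c) c′ _ _ c+1<c′ ex e′))

  column-adjacent : ∀ {r r′ c} → r < r′ → F r c ≡ just (num m) → F r′ c ≡ just dot → r′ ≡ suc r
  column-adjacent {r} {r′} {c} r<r′ e e′ with m≤n⇒m<n∨m≡n r<r′
  ... | inj₂ eq = sym eq
  ... | inj₁ r+1<r′ with entry {suc r} {c} (≤-trans (mu-partition r) (proj₁ (inside e)))
                           (<-≤-trans (proj₂ (inside e′)) (part-antitone lam lam-partition (<⇒≤ r+1<r′)))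
  ...   | x , ex = ⊥-elim (LtAt-gap m x (column-increasing r (suc r) c _ _ ≤-refl e ex)
                                       (column-increasing (suc r) r′ c _ _ r+1<r′ ex e′))

revKjdt-sInc : ∀ m F → IsSInc (suc m) F → IsSInc m (revKjdt (suc m) F)
revKjdt-sInc m F S@((lam , mu , pl , pm , sub , sh) , pos , rows , cols) =
  (lam , mu , pl , pm , sub , revKjdt-shape (suc m) F lam mu sh) , pos′ , rows′ , cols′
  where
  open SIncLemmas S using (row-adjacent; column-adjacent)
  F′ = revKjdt (suc m) F
  pos′ : PositiveEntries F′
  pos′ r c n e′ with revKjdt-change (suc m) F e′
  ... | _ , e , fixed _ = pos r c n e
  ... | _ , e , stays = s≤s z≤n
  ... | _ , e , fills = s≤s z≤n

  rows′ : ∀ r c c′ e e′ → c < c′ → F′ r c ≡ just e → F′ r c′ ≡ just e′ → LtAt m e e′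
  rows′ r c c′ y y′ c<c′ ey ey′
    with revKjdt-change (suc m) F ey | revKjdt-change (suc m) F ey′
  ... | x , ex , ch | x′ , ex′ , ch′ = LtAt-change m F ch ch′ (rows r c c′ x x′ c<c′ ex ex′) swap
    where
    swap : x ≡ num (suc m) → x′ ≡ dot → y ≡ dot × y′ ≡ num (suc m)
    swap refl refl with row-adjacent c<c′ ex ex′
    ... | refl = just-injective (trans (sym ey) (revKjdt-num-swaps (suc m) F ex (right ex′))) ,
                 just-injective (trans (sym ey′) (revKjdt-dot-swaps (suc m) F ex′ (left ex)))

  cols′ : ∀ r r′ c e e′ → r < r′ → F′ r c ≡ just e → F′ r′ c ≡ just e′ → LtAt m e e′
  cols′ r r′ c y y′ r<r′ ey ey′
    with revKjdt-change (suc m) F ey | revKjdt-change (suc m) F ey′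
  ... | x , ex , ch | x′ , ex′ , ch′ = LtAt-change m F ch ch′ (cols r r′ c x x′ r<r′ ex ex′) swap
    where
    swap : x ≡ num (suc m) → x′ ≡ dot → y ≡ dot × y′ ≡ num (suc m)
    swap refl refl with column-adjacent r<r′ ex ex′
    ... | refl = just-injective (trans (sym ey) (revKjdt-num-swaps (suc m) F ex (below ex′))) ,
                 just-injective (trans (sym ey′) (revKjdt-dot-swaps (suc m) F ex′ (above ex)))

-- Row counts of columns

<ᵇ-true : ∀ {a b} → a < b → (a <ᵇ b) ≡ true
<ᵇ-true {a} {b} a<b with a <ᵇ b | <⇒<ᵇ a<b
... | true | _ = refl

<ᵇ-false : ∀ {a b} → b ≤ a → (a <ᵇ b) ≡ false
<ᵇ-false {a} {b} b≤a with a <ᵇ b | <ᵇ⇒< a b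
... | false | _ = refl
... | true  | lt = ⊥-elim (1+n≰n (≤-trans (lt tt) b≤a))

<ᵇ-elim : ∀ {a b} → (a <ᵇ b) ≡ true → a < b
<ᵇ-elim {a} {b} e = <ᵇ⇒< a b (subst T (sym e) tt)

anyBelow : ℕ → (ℕ → Bool) → Bool
anyBelow zero    f = false
anyBelow (suc K) f = f K ∨ anyBelow K f

count : ℕ → (ℕ → Bool) → ℕ
count zero    f = 0
count (suc K) f = [ f K ] + count K f

anyBelow-true : ∀ K f → anyBelow K f ≡ true → ∃[ r ] (r < K × f r ≡ true)
anyBelow-true (suc K) f e with f K in eq
... | true = K , ≤-refl , eq
... | false with anyBelow-true K f e
...   | r , r<K , fr = r , m≤n⇒m≤1+n r<K , fr

anyBelow-intro : ∀ K f {r} → r < K → f r ≡ true → anyBelow K f ≡ true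
anyBelow-intro (suc K) f {r} r<1+K fr with m≤n⇒m<n∨m≡n (≤-pred r<1+K)
... | inj₂ refl rewrite fr = refl
... | inj₁ r<K rewrite anyBelow-intro K f r<K fr = ∨-zeroʳ (f K)

[_]-mono : ∀ {a b} → (a ≡ true → b ≡ true) → [ a ] ≤ [ b ]
[_]-mono {false} f = z≤n
[_]-mono {true}  f rewrite f refl = ≤-refl

count-mono : ∀ K {f g} → (∀ r → f r ≡ true → g r ≡ true) → count K f ≤ count K g
count-mono zero    h = z≤n
count-mono (suc K) h = +-mono-≤ ([_]-mono (h K)) (count-mono K h)

count-+ : ∀ K {f g h} → (∀ r → [ f r ] ≡ [ g r ] + [ h r ]) → count K f ≡ count K g + count K h
count-+ zero    e = refl
count-+ (suc K) {f} {g} {h} e rewrite e K | count-+ K {f} {g} {h} e =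
  interchange [ g K ] [ h K ] (count K g) (count K h)

count-∪ : ∀ K {f g h} → (∀ r → f r ≡ true → g r ≡ true ⊎ h r ≡ true) → count K f ≤ count K g + count K h
count-∪ zero    e = z≤n
count-∪ (suc K) {f} {g} {h} e = ≤-trans (+-mono-≤ (at (e K)) (count-∪ K {f} {g} {h} e))
  (≤-reflexive (interchange [ g K ] [ h K ] (count K g) (count K h)))
  where
  at : ∀ {a b c} → (a ≡ true → b ≡ true ⊎ c ≡ true) → [ a ] ≤ [ b ] + [ c ]
  at {false} _ = z≤n
  at {true} i with i refl
  ... | inj₁ refl = s≤s z≤n
  ... | inj₂ refl = m≤n+m 1 _

count-unique : ∀ K f → (∀ r r′ → f r ≡ true → f r′ ≡ true → r ≡ r′) → count K f ≡ [ anyBelow K f ]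
count-unique zero    f u = refl
count-unique (suc K) f u with f K in eq
... | false = count-unique K f u
... | true  = cong suc (trans (count-unique K f u) (cong [_] (≡false none)))
  where
  none : anyBelow K f ≡ true → ⊥
  none e with anyBelow-true K f e
  ... | r , r<K , fr = <⇒≢ r<K (u r K fr eq)

column : ℕ → Filling → ℕ → NSet
column K F c v = anyBelow K (λ r → isNum v (F r c))

hasDot : ℕ → Filling → ℕ → Bool
hasDot K F c = anyBelow K (λ r → isDot (F r c))

RowBound : ℕ → Filling → Set
RowBound K F = ∀ r c → K ≤ r → F r c ≡ nothing

module _ {K : ℕ} {F : Filling} (bd : RowBound K F) where
  row-inside : ∀ {r c e} → F r c ≡ just e → r < K
  row-inside {r} {c} eq with <-≤-connex r K
  ... | inj₁ r<K = r<K
  ... | inj₂ K≤r with trans (sym (bd r c K≤r)) eq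
  ...   | ()

  column-intro : ∀ {r c v} → F r c ≡ just (num v) → column K F c v ≡ true
  column-intro {v = v} e = anyBelow-intro K _ (row-inside e) (isNum-intro v e)

  column-elim : ∀ {c v} → column K F c v ≡ true → ∃[ r ] (F r c ≡ just (num v))
  column-elim {c} {v} e with anyBelow-true K _ e
  ... | r , _ , i = r , isNum-true v (F r c) i

  hasDot-intro : ∀ {r c} → F r c ≡ just dot → hasDot K F c ≡ true
  hasDot-intro e = anyBelow-intro K _ (row-inside e) (isDot-intro e)

  hasDot-elim : ∀ {c} → hasDot K F c ≡ true → ∃[ r ] (F r c ≡ just dot)
  hasDot-elim {c} e with anyBelow-true K _ e
  ... | r , _ , i = r , isDot-true (F r c) i

column-cong : ∀ {K K′ F F′ c v} → RowBound K F → RowBound K′ F′ →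
  (∀ r → F r c ≡ just (num v) → ∃[ r′ ] (F′ r′ c ≡ just (num v))) →
  (∀ r → F′ r c ≡ just (num v) → ∃[ r′ ] (F r′ c ≡ just (num v))) →
  column K F c v ≡ column K′ F′ c v
column-cong bd bd′ f g = ≡-from-⇔
  (λ e → column-intro bd′ (proj₂ (f _ (proj₂ (column-elim bd e)))))
  (λ e → column-intro bd (proj₂ (g _ (proj₂ (column-elim bd′ e)))))

-- A bullet lies between m and m + 1; o decides the cells outside the shape.
before : Bool → ℕ → ℕ → Maybe Entry → Bool
before o m v nothing        = o
before o m v (just (num n)) = n <ᵇ v
before o m v (just dot)     = m <ᵇ v

-- Between `m` and `suc m` a bullet also starts to count, although it is no member of the column;
-- the hypothesis keeps `v` away from that jump.
before-suc : ∀ o m v x → (x ≡ just dot → v ≢ m) →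
  [ before o m (suc v) x ] ≡ [ before o m v x ] + [ isNum v x ]
before-suc o m v nothing h = sym (+-identityʳ [ o ])
before-suc o m v (just dot) h with <-cmp m v
... | tri≈ _ e _ = ⊥-elim (h refl (sym e))
... | tri< m<v _ _ rewrite <ᵇ-true m<v | <ᵇ-true (m≤n⇒m≤1+n m<v) = refl
... | tri> _ _ v<m rewrite <ᵇ-false v<m | <ᵇ-false (<⇒≤ v<m) = refl
before-suc o m v (just (num n)) h with n ≟ v
... | yes refl rewrite <ᵇ-true (≤-refl {suc n}) | <ᵇ-false (≤-refl {n}) = refl
... | no n≢v with <-cmp n v
...   | tri≈ _ e _ = ⊥-elim (n≢v e)
...   | tri< n<v _ _ rewrite <ᵇ-true n<v | <ᵇ-true (m≤n⇒m≤1+n n<v) = refl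
...   | tri> _ _ v<n rewrite <ᵇ-false v<n | <ᵇ-false (<⇒≤ v<n) = refl

rowsBefore : ℕ → (ℕ → Bool) → ℕ → Filling → ℕ → ℕ → ℕ
rowsBefore K o m F c v = count K (λ r → before (o r) m v (F r c))

column-functional : ∀ {m F} → IncreasingAt m F → ∀ {c v r r′} →
  F r c ≡ just (num v) → F r′ c ≡ just (num v) → r ≡ r′
column-functional inc {c} {v} {r} {r′} e e′ with <-cmp r r′
... | tri≈ _ eq _ = eq
... | tri< lt _ _ = ⊥-elim (1+n≰n (proj₂ inc r r′ c _ _ lt e e′))
... | tri> _ _ gt = ⊥-elim (1+n≰n (proj₂ inc r′ r c _ _ gt e′ e))

dot-functional : ∀ {m F} → IncreasingAt m F → ∀ {c r r′} →
  F r c ≡ just dot → F r′ c ≡ just dot → r ≡ r′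
dot-functional inc {c} {r} {r′} e e′ with <-cmp r r′
... | tri≈ _ eq _ = eq
... | tri< lt _ _ = ⊥-elim (proj₂ inc r r′ c _ _ lt e e′)
... | tri> _ _ gt = ⊥-elim (proj₂ inc r′ r c _ _ gt e′ e)

rowsBefore-suc : ∀ K o m {m₀ F} → IncreasingAt m₀ F → ∀ c v →
  (∀ r → F r c ≡ just dot → v ≢ m) →
  rowsBefore K o m F c (suc v) ≡ rowsBefore K o m F c v + [ column K F c v ]
rowsBefore-suc K o m {F = F} inc c v h =
  trans (count-+ K {h = λ r → isNum v (F r c)} (λ r → before-suc (o r) m v (F r c) (h r)))
        (cong (rowsBefore K o m F c v +_) (count-unique K _
          (λ r r′ e e′ → column-functional inc (isNum-true v _ e) (isNum-true v _ e′))))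

module SIncColumns {m : ℕ} {F : Filling} (S : IsSInc m F) (K : ℕ) where
  open SIncLemmas S
  incr : IncreasingAt m F
  incr = proj₂ (proj₂ S)

  rows : ℕ → ℕ → ℕ
  rows c = rowsBefore K (λ r → c <ᵇ part mu r) m F c

  rows-suc : ∀ c v → v ≢ m → rows c (suc v) ≡ rows c v + [ column K F c v ]
  rows-suc c v v≢m = rowsBefore-suc K _ m incr c v (λ _ _ → v≢m)

  missing-left : ∀ {r c c′ e} → c ≤ c′ → F r c ≡ nothing → F r c′ ≡ just e → c < part mu r
  missing-left {r} {c} {c′} c≤c′ e e′ with <-≤-connex c (part mu r)
  ... | inj₁ c<mu = c<mu
  ... | inj₂ mu≤c with entry mu≤c (≤-<-trans c≤c′ (proj₂ (inside e′)))
  ...   | _ , e″ with trans (sym e) e″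
  ...     | ()

  -- Rows are strict, so a right entry `≤ v` has a left neighbour `< v`. At `v = m` this fails
  -- exactly for the pair `m`, bullet, because neither value lies strictly between them.
  rows-shift : ∀ c v → v ≢ m → rows (suc c) (suc v) ≤ rows c v
  rows-shift c v v≢m = count-mono K at
    where
    at : ∀ r → before (suc c <ᵇ part mu r) m (suc v) (F r (suc c)) ≡ true →
               before (c <ᵇ part mu r) m v (F r c) ≡ true
    at r b with F r (suc c) in eq₁ | F r c in eq₀
    ... | nothing | nothing = <ᵇ-true (<-trans ≤-refl (<ᵇ-elim {suc c} {part mu r} b))
    ... | nothing | just e = ⊥-elim (<⇒≱ (<-trans ≤-refl (<ᵇ-elim {suc c} b)) (proj₁ (inside eq₀)))
    ... | just e  | nothing = <ᵇ-true (missing-left (n≤1+n c) eq₀ eq₁)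
    ... | just (num n) | just (num k) =
      <ᵇ-true (<-≤-trans (row-increasing r c (suc c) _ _ ≤-refl eq₀ eq₁) (≤-pred (<ᵇ-elim {n} b)))
    ... | just (num n) | just dot =
      <ᵇ-true (<-≤-trans (row-increasing r c (suc c) _ _ ≤-refl eq₀ eq₁) (≤-pred (<ᵇ-elim {n} b)))
    ... | just dot | just dot = ⊥-elim (row-increasing r c (suc c) _ _ ≤-refl eq₀ eq₁)
    ... | just dot | just (num k) =
      <ᵇ-true (≤-<-trans (row-increasing r c (suc c) _ _ ≤-refl eq₀ eq₁)
                         (≤∧≢⇒< (≤-pred (<ᵇ-elim {m} b)) (λ e → v≢m (sym e))))

  module _ (bd : RowBound K F) {r₀ c : ℕ} (cell : F r₀ c ≡ just (num m)) (next : F r₀ (suc c) ≡ just dot) where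

    above-shape : ∀ {r} → r < r₀ → F r (suc c) ≡ nothing → suc c < part mu r
    above-shape {r} r<r₀ e with <-≤-connex (suc c) (part mu r)
    ... | inj₁ lt = lt
    ... | inj₂ mu≤ with entry mu≤ (<-≤-trans (proj₂ (inside next)) (part-antitone lam lam-partition (<⇒≤ r<r₀)))
    ...   | _ , e″ with trans (sym e) e″
    ...     | ()

    not-before-below : ∀ {r} → r₀ ≤ r → c < part mu r → ⊥
    not-before-below r₀≤r c<mu =
      <⇒≱ c<mu (≤-trans (part-antitone mu mu-partition r₀≤r) (proj₁ (inside cell)))

    -- Row `r₀` splits the count. Down to `r₀` every right cell is before `suc m`, by comparison
    -- with the bullet in `r₀`. Below `r₀` the left entries come after `m`, so only a bullet of
    -- column `c` can count.
    rows-swap-high : rows c (suc m) ≤ rows (suc c) (suc m) + [ hasDot K F c ]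
    rows-swap-high = subst (λ d → rows c (suc m) ≤ rows (suc c) (suc m) + d)
        (count-unique K _ (λ r r′ e e′ → dot-functional incr (isDot-true _ e) (isDot-true _ e′)))
        (count-∪ K at)
      where
      at : ∀ r → before (c <ᵇ part mu r) m (suc m) (F r c) ≡ true →
           before (suc c <ᵇ part mu r) m (suc m) (F r (suc c)) ≡ true ⊎ isDot (F r c) ≡ true
      at r b with <-≤-connex r₀ r
      ... | inj₁ r₀<r with F r c in eq
      ...   | nothing = ⊥-elim (not-before-below (<⇒≤ r₀<r) (<ᵇ-elim b))
      ...   | just dot = inj₂ refl
      ...   | just (num n) = ⊥-elim (<⇒≱ (column-increasing r₀ r c _ _ r₀<r cell eq) (≤-pred (<ᵇ-elim {n} b)))
      at r b | inj₂ r≤r₀ = inj₁ right-before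
        where
        right-before : before (suc c <ᵇ part mu r) m (suc m) (F r (suc c)) ≡ true
        right-before with F r (suc c) in eq | m≤n⇒m<n∨m≡n r≤r₀
        ... | just dot | _ = <ᵇ-true {m} ≤-refl
        ... | just (num n) | inj₁ r<r₀ = <ᵇ-true (s≤s (column-increasing r r₀ (suc c) _ _ r<r₀ eq next))
        ... | nothing | inj₁ r<r₀ = <ᵇ-true (above-shape r<r₀ eq)
        ... | just (num n) | inj₂ refl with trans (sym eq) next
        ...   | ()
        right-before | nothing | inj₂ refl with trans (sym eq) next
        ...   | ()

    -- No row straddles `m`: from `r₀` on the left entries are at least `m`, and above `r₀` the
    -- right entries are at most `m` but different from it. This is where saturation starts when a
    -- gain is absorbed.
    rows-swap-low : column K F (suc c) m ≡ false → rows c m ≤ rows (suc c) m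
    rows-swap-low m∉ = count-mono K at
      where
      at : ∀ r → before (c <ᵇ part mu r) m m (F r c) ≡ true →
           before (suc c <ᵇ part mu r) m m (F r (suc c)) ≡ true
      at r b with <-≤-connex r r₀
      ... | inj₂ r₀≤r = ⊥-elim (not-before r₀≤r b)
        where
        not-before : r₀ ≤ r → before (c <ᵇ part mu r) m m (F r c) ≡ true → ⊥
        not-before r₀≤r b with F r c in eq | m≤n⇒m<n∨m≡n r₀≤r
        ... | nothing | _ = not-before-below r₀≤r (<ᵇ-elim b)
        ... | just dot | _ = 1+n≰n (<ᵇ-elim {m} b)
        ... | just (num n) | inj₁ r₀<r =
          <⇒≱ (column-increasing r₀ r c _ _ r₀<r cell eq) (<⇒≤ (<ᵇ-elim {n} b))
        ... | just (num n) | inj₂ refl with trans (sym eq) cell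
        ...   | refl = 1+n≰n (<ᵇ-elim {n} b)
      ... | inj₁ r<r₀ with F r (suc c) in eq
      ...   | nothing = <ᵇ-true (above-shape r<r₀ eq)
      ...   | just dot = ⊥-elim (column-increasing r r₀ (suc c) _ _ r<r₀ eq next)
      ...   | just (num n) = <ᵇ-true (≤∧≢⇒< (column-increasing r r₀ (suc c) _ _ r<r₀ eq next)
                (λ { refl → false≢true m∉ (column-intro bd eq) }))

-- The effect of one slide on the columns

-- X = a j ◁ (a (j + 1) ◁ ⋯ ◁ a (j + k))
Chain : (ℕ → NSet) → ℕ → ℕ → NSet → Set
Chain a j zero    X = X ≗ a j
Chain a j (suc k) X = ∃[ Y ] (Chain a (suc j) k Y × Match (a j) Y X)

Chain-⊆ : ∀ a j k {X} → Chain a j k X → ∀ v → X v ≡ true → a j v ≡ true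
Chain-⊆ a j zero    X≐ v Xv = trans (sym (X≐ v)) Xv
Chain-⊆ a j (suc k) (_ , _ , M) v Xv = Match-⊆ M v Xv

Chain-cong : ∀ {a a′ X} j k → (∀ c → a c ≗ a′ c) → Chain a j k X → Chain a′ j k X
Chain-cong j zero    e X≐ v = trans (X≐ v) (e j v)
Chain-cong j (suc k) e (Y , ch , M) =
  Y , Chain-cong (suc j) k e ch , Match-cong (e j) (λ _ → refl) (λ _ → refl) M

column-bounded : ∀ K F c → ∃[ N ] (∀ v → N ≤ v → column K F c v ≡ false)
column-bounded zero    F c = 0 , λ _ _ → refl
column-bounded (suc K) F c with column-bounded K F c
... | N , b = N ⊔ beyond (F K c) , λ v ≤v → cong₂ _∨_
      (isNum-beyond (F K c) v (≤-trans (m≤n⊔m N _) ≤v)) (b v (≤-trans (m≤m⊔n N _) ≤v))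
  where
  beyond : Maybe Entry → ℕ
  beyond (just (num n)) = suc n
  beyond _              = 0
  isNum-beyond : ∀ x v → beyond x ≤ v → isNum v x ≡ false
  isNum-beyond nothing v _ = refl
  isNum-beyond (just dot) v _ = refl
  isNum-beyond (just (num n)) v n<v with n ≟ v
  ... | yes refl = ⊥-elim (1+n≰n n<v)
  ... | no _     = refl

module Step {m′ : ℕ} {F : Filling} (S : IsSInc (suc m′) F) {K : ℕ} (bd : RowBound K F) where
  m = suc m′
  F′ = revKjdt m F
  open SIncLemmas S
  open SIncColumns S K

  bd′ : RowBound K F′
  bd′ r c K≤r = revKjdt-nothing m F (bd r c K≤r)

  col col′ : ℕ → NSet
  col  = column K F
  col′ = column K F′

  col-other : ∀ c v → v ≢ m → col c v ≡ col′ c v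
  col-other c v v≢m = column-cong bd bd′ (λ r e → r , revKjdt-other m F v≢m e) back
    where
    back : ∀ r → F′ r c ≡ just (num v) → ∃[ r′ ] (F r′ c ≡ just (num v))
    back r e with revKjdt-change m F e
    ... | _ , e₀ , fixed _ = r , e₀
    ... | _ , e₀ , stays = ⊥-elim (v≢m refl)
    ... | _ , e₀ , fills = ⊥-elim (v≢m refl)

  col-same : ∀ c → col c m ≡ col′ c m → col c ≗ col′ c
  col-same c e v with v ≟ m
  ... | yes refl = e
  ... | no v≢m   = col-other c v v≢m

  lacks-num : ∀ {c} → col c m ≡ false → ∀ r → F r c ≢ just (num m)
  lacks-num m∉ r e = false≢true m∉ (column-intro bd e)

  lacks-dot : ∀ {c} → hasDot K F c ≡ false → ∀ r → F r c ≢ just dot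
  lacks-dot ∙∉ r e = false≢true ∙∉ (hasDot-intro bd e)

  dot-before-num : ∀ {r c c′} → c < c′ → F r c ≡ just dot → F r c′ ≢ just (num m)
  dot-before-num {r} {c} {c′} c<c′ e e′ = 1+n≰n (row-increasing r c c′ _ _ c<c′ e e′)

  -- The two cells are adjacent with `m` on top, so the bullet turns into `m`: a vertical exchange
  -- never costs the column its `m`.
  col-both : ∀ c → col c m ≡ true → hasDot K F c ≡ true → col′ c m ≡ true
  col-both c m∈ ∙∈ with column-elim bd m∈ | hasDot-elim bd ∙∈
  ... | r , e | r′ , e′ with <-cmp r r′
  ...   | tri> _ _ r′<r = ⊥-elim (1+n≰n (column-increasing r′ r c _ _ r′<r e′ e))
  ...   | tri≈ _ refl _ with trans (sym e) e′
  ...     | ()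
  col-both c m∈ ∙∈ | r , e | r′ , e′ | tri< r<r′ _ _ with column-adjacent r<r′ e e′
  ... | refl = column-intro bd′ (revKjdt-dot-swaps m F e′ (above e))

  data Status (c : ℕ) : Set where
    keeps : col c ≗ col′ c → Status c
    loses : ∀ r → F r c ≡ just (num m) → F r (suc c) ≡ just dot →
           hasDot K F c ≡ false → col′ c m ≡ false → Status c
    gains : ∀ r c₀ → c ≡ suc c₀ → F r c₀ ≡ just (num m) → F r c ≡ just dot →
           col c m ≡ false → col′ c m ≡ true → Status c

  status : ∀ c → Status c
  -- A column has at most one `m` and at most one bullet. With both or neither its set is kept. With
  -- exactly one, it changes only through a horizontal exchange, and the row order forces the `m` to
  -- stand on the left.
  status c with col c m in m? | hasDot K F c in ∙?
  ... | true | true = keeps (col-same c (trans m? (sym (col-both c m? ∙?))))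
  ... | false | false = keeps (col-same c (trans m? (sym (≡false none))))
    where
    none : col′ c m ≡ true → ⊥
    none e with column-elim bd′ e
    ... | r , e′ with revKjdt-change m F e′
    ...   | _ , e₀ , fixed _ = lacks-num m? r e₀
    ...   | _ , e₀ , stays = lacks-num m? r e₀
    ...   | _ , e₀ , fills = lacks-dot ∙? r e₀
  ... | true | false with column-elim bd m?
  ...   | r , e with revKjdt-num m F e
  ...     | inj₂ (_ , e′) = keeps (col-same c (trans m? (sym (column-intro bd′ e′))))
  ...     | inj₁ (below d , _) = ⊥-elim (lacks-dot ∙? _ d)
  ...     | inj₁ (above d , _) = ⊥-elim (lacks-dot ∙? _ d)
  ...     | inj₁ (left d , _) = ⊥-elim (dot-before-num ≤-refl d e)
  ...     | inj₁ (right d , e′) = loses r e d ∙? (≡false gone)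
    where
    gone : col′ c m ≡ true → ⊥
    gone f with column-elim bd′ f
    ... | r₁ , f′ with revKjdt-change m F f′
    ...   | _ , e₀ , fixed m≢m = m≢m refl
    ...   | _ , e₀ , fills = lacks-dot ∙? r₁ e₀
    ...   | _ , e₀ , stays with column-functional incr e e₀
    ...     | refl with trans (sym e′) f′
    ...       | ()
  status c | false | true with hasDot-elim bd ∙?
  ...   | r , e with revKjdt-dot m F e
  ...     | inj₁ (below d , _) = ⊥-elim (lacks-num m? _ d)
  ...     | inj₁ (above d , _) = ⊥-elim (lacks-num m? _ d)
  ...     | inj₁ (right d , _) = ⊥-elim (dot-before-num ≤-refl e d)
  ...     | inj₁ (left d , e′) = gains r _ refl d e m? (column-intro bd′ e′)
  ...     | inj₂ (_ , e′) = keeps (col-same c (trans m? (sym (≡false none))))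
    where
    none : col′ c m ≡ true → ⊥
    none f with column-elim bd′ f
    ... | r₁ , f′ with revKjdt-change m F f′
    ...   | _ , e₀ , fixed m≢m = m≢m refl
    ...   | _ , e₀ , stays = lacks-num m? r₁ e₀
    ...   | _ , e₀ , fills with dot-functional incr e e₀
    ...     | refl with trans (sym e′) f′
    ...       | ()

  -- The `m` to the left of the bullet is recorded because it lets the previous column absorb the
  -- gain. The equation `c ≡ suc c₀` rules out a gain in column 0.
  Gained : ℕ → NSet → NSet → Set
  Gained c X X′ = ∃[ r ] ∃[ c₀ ] (c ≡ suc c₀ × F r c₀ ≡ just (num m) × F r c ≡ just dot ×
                                  col c m ≡ false × Gain m (col c) X X′)

  -- Above `m` bullets do not disturb the row counts, so `pending-bounded` applies down to `suc m`.
  -- There `rows-swap-high` leaves room for at most one request, and only if column `c` has a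
  -- bullet.
  pending-at-swap : ∀ {r c X Y} (M : Match (col c) Y X) → (∀ v → Y v ≡ true → col (suc c) v ≡ true) →
    F r c ≡ just (num m) → F r (suc c) ≡ just dot → Match.p M (suc m) ≤ [ hasDot K F c ]
  pending-at-swap {c = c} {Y = Y} M Y⊆ cell next = +-cancelʳ-≤ (rows (suc c) (suc m)) _ _
      (≤-trans (pending-bounded M (rows c) (rows (suc c)) (suc m)
                 (λ v m<v → ≤-reflexive (rows-suc c v (≢m m<v)))
                 (λ v m<v → ≤-trans (+-monoʳ-≤ (rows (suc c) v) ([_]-mono (Y⊆ v)))
                                    (≤-reflexive (sym (rows-suc (suc c) v (≢m m<v)))))
                 (λ v m<v → rows-shift c v (≢m m<v))
                 (suc m) ≤-refl)
               (≤-trans (rows-swap-high bd cell next) (≤-reflexive (+-comm (rows (suc c) (suc m)) _))))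
    where
    ≢m : ∀ {v} → m < v → v ≢ m
    ≢m m<v refl = 1+n≰n m<v

  Chain-step : ∀ C → (∀ r c n → C ≤ c → F′ r c ≢ just (num n)) →
    ∀ k j {X} → suc (j + k) ≡ C → Chain col j k X →
    ∃[ X′ ] (Chain col′ j k X′ × (X ≗ X′ ⊎ Gained j X X′))
  Chain-step C none zero j {X} eq X≐ with status j
  ... | keeps e = col′ j , (λ _ → refl) , inj₁ (λ v → trans (X≐ v) (e v))
  -- The exchange would put `m` into column `C`, where `none` admits no number.
  ... | loses r cell next _ _ = ⊥-elim (none r (suc j) m
          (≤-reflexive (trans (sym eq) (cong suc (+-identityʳ j))))
          (revKjdt-dot-swaps m F next (left cell)))
  ... | gains r c₀ jeq before cell m∉ m∈ = col′ j , (λ _ → refl) ,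
          inj₂ (r , c₀ , jeq , before , cell , m∉ , record
            { same-above = λ v m<v → trans (X≐ v) (col-other j v λ { refl → 1+n≰n m<v })
            ; lacks = trans (X≐ m) m∉
            ; has = m∈
            -- The last column is its own `X`, so the new `m` pushes nothing out and the zone
            -- reaches down to 0.
            ; zone = λ _ → true
            ; zone-start = refl
            ; zone-step = λ v v<m → stay-≡ (X≐ v) (col-other j v λ { refl → 1+n≰n v<m }) })
    where
    stay-≡ : ∀ {d x x′} → x ≡ d → d ≡ x′ → ZoneStep true true d x x′
    stay-≡ refl refl = stay
  Chain-step C none (suc k) j {X} eq (Y , ch , M)
    with Chain-step C none k (suc j) (trans (cong suc (sym (+-suc j k))) eq) ch
  ... | Y′ , ch′ , rel = X′ , (Y′ , ch′ , M′) , by-status rel (status j)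
    where
    Y⊆ = Chain-⊆ col (suc j) k ch
    Y′⊆ = Chain-⊆ col′ (suc j) k ch′
    N = proj₁ (column-bounded K F′ (suc j))
    ∃X′ = Match-exists (col′ j) Y′ N
      (λ v N≤v → ≡false (λ y → false≢true (proj₂ (column-bounded K F′ (suc j)) v N≤v) (Y′⊆ v y)))
    X′ = proj₁ ∃X′
    M′ = proj₂ ∃X′

    by-status : Y ≗ Y′ ⊎ Gained (suc j) Y Y′ → Status j → X ≗ X′ ⊎ Gained j X X′
    by-status (inj₁ e) (keeps s) = inj₁ (Match-unique M M′ s e)
    by-status (inj₁ e) (loses r cell next ∙∉ m∉) = inj₁ (Match-lose M M′ (col-other j) m∉
      (n≤0⇒n≡0 (subst (λ d → Match.p M (suc m) ≤ [ d ]) ∙∉ (pending-at-swap M Y⊆ cell next))) e)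
    by-status (inj₁ e) (gains r c₀ jeq before cell m∉ m∈)
      with Match-gain M M′ (col-other j) m∉ m∈ e
    ... | inj₁ s = inj₁ s
    ... | inj₂ g = inj₂ (r , c₀ , jeq , before , cell , m∉ , g)
    -- Both fates of the `m` in column `j` are covered at once: with a bullet in the column it
    -- survives, by `col-both`; without one nobody waits at `m`. Either way at most `[ col′ j m ]`
    -- requests are pending.
    by-status (inj₂ (r , .j , refl , cell , next , m∉ , g)) _ = inj₁
      (Match-absorb M M′ (col-other j) (rows j) (rows (suc j)) g m∈
        (≤-trans (pending-at-swap M Y⊆ cell next) ([_]-mono (col-both j m∈)))
        (λ v v<m → ≤-reflexive (sym (rows-suc j v (≢m v<m))))
        (λ v v<m → ≤-reflexive (rows-suc (suc j) v (≢m v<m)))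
        (λ v v<m → rows-shift j v (≢m v<m))
        (rows-swap-low bd cell next m∉))
      where
      m∈ : col j m ≡ true
      m∈ = column-intro bd cell
      ≢m : ∀ {v} → v < m → v ≢ m
      ≢m v<m refl = 1+n≰n v<m

  first-column-fixed : ∀ {X X′} → X ≗ X′ ⊎ Gained 0 X X′ → X ≗ X′
  first-column-fixed (inj₁ e) = e

  -- A bullet left of `m` would break the row order, so an exchanged `m` reappears in the same
  -- column or the next one to the right. Read backwards, having no numbers beyond `C` after the
  -- slide implies the same before it.
  num-beyond : ∀ C r c n → C ≤ c → F r c ≡ just (num n) →
    ∃[ r′ ] ∃[ c′ ] ∃[ n′ ] (C ≤ c′ × F′ r′ c′ ≡ just (num n′))
  num-beyond C r c n C≤c e with n ≟ m
  ... | no n≢m = r , c , n , C≤c , revKjdt-other m F n≢m e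
  ... | yes refl with revKjdt-num m F e
  ...   | inj₂ (_ , e′) = r , c , n , C≤c , e′
  ...   | inj₁ (below d , _) = _ , _ , _ , C≤c , revKjdt-dot-swaps m F d (above e)
  ...   | inj₁ (right d , _) = _ , _ , _ , m≤n⇒m≤1+n C≤c , revKjdt-dot-swaps m F d (left e)
  ...   | inj₁ (above d , _) = _ , _ , _ , C≤c , revKjdt-dot-swaps m F d (below e)
  ...   | inj₁ (left d , _) = ⊥-elim (dot-before-num ≤-refl d e)

-- The greedy rule on lists

-- One request s more: it raises the pending count on the interval [l , s], where
-- l = t + 1 if s picks t, and l = 0 if s picks nothing.
Match-insert : ∀ {T T′ S S′ X X′} (M : Match T′ S′ X′) l s → l ≤ s →
  S s ≡ true → (∀ v → v ≢ s → S v ≡ S′ v) → (∀ v → s ≤ v → S′ v ≡ false) →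
  (∀ v → suc v ≡ l → T v ≡ true × T′ v ≡ false × X v ≡ true) →
  (∀ v → suc v ≢ l → T v ≡ T′ v × X v ≡ X′ v) →
  (∀ v → l ≤ v → v < s → T v ≡ false) →
  Match T S X
Match-insert {T} {T′} {S} {S′} {X} {X′} M l s l≤s Ss S-other S′-below picked other gap =
    match q (suc s) (λ v s<v → cong₂ _+_ (p-above v (<⇒≤ s<v)) (boost-above s<v)) sweep′ out′
  where
  open Match M
  boost q : ℕ → ℕ
  boost v = [ (l <ᵇ suc v) ∧ (v <ᵇ suc s) ]
  q v = p v + boost v

  boost-in : ∀ {v} → l ≤ v → v ≤ s → boost v ≡ 1
  boost-in l≤v v≤s rewrite <ᵇ-true (s≤s l≤v) | <ᵇ-true (s≤s v≤s) = refl
  boost-below : ∀ {v} → v < l → boost v ≡ 0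
  boost-below v<l rewrite <ᵇ-false v<l = refl
  boost-above : ∀ {v} → s < v → boost v ≡ 0
  boost-above {v} s<v rewrite <ᵇ-false s<v | ∧-zeroʳ (l <ᵇ suc v) = refl

  p-above : ∀ v → s ≤ v → p v ≡ 0
  p-above = descend _ top s (λ v _ → idle v) next
    where
    next : ∀ v → s ≤ v → p (suc v) ≡ 0 → p v ≡ 0
    next v s≤v e rewrite sweep v | e | S′-below v s≤v | 0∸n≡0 [ T′ v ] = refl

  sweep′ : ∀ v → q v ≡ (q (suc v) ∸ [ T v ]) + [ S v ]
  sweep′ v with <-cmp v s
  ... | tri> _ v≢s s<v
    rewrite p-above v (<⇒≤ s<v) | p-above (suc v) (m≤n⇒m≤1+n (<⇒≤ s<v)) | boost-above s<v
          | boost-above (m≤n⇒m≤1+n s<v) | S-other v v≢s | S′-below v (<⇒≤ s<v) | 0∸n≡0 [ T v ] = refl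
  ... | tri≈ _ refl _
    rewrite p-above v ≤-refl | p-above (suc v) (n≤1+n v) | boost-in l≤s ≤-refl
          | boost-above (≤-refl {suc v}) | Ss | 0∸n≡0 [ T v ] = refl
  ... | tri< v<s v≢s _ with <-cmp l (suc v)
  ...   | tri≈ _ refl _ rewrite sweep v | boost-below {v} ≤-refl | boost-in {suc v} ≤-refl v<s
                              | proj₁ (picked v refl) | proj₁ (proj₂ (picked v refl)) | S-other v v≢s
                              | m+n∸n≡m (p (suc v)) 1 = +-identityʳ _
  ...   | tri> _ l≢ v+1<l rewrite boost-below {v} (<-trans ≤-refl v+1<l) | boost-below v+1<l
                              | proj₁ (other v (l≢ ∘ sym)) | S-other v v≢s | +-identityʳ (p v)
                              | +-identityʳ (p (suc v)) = sweep v
  ...   | tri< (s≤s l≤v) l≢ _ rewrite sweep v | boost-in l≤v (<⇒≤ v<s) | boost-in (m≤n⇒m≤1+n l≤v) v<s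
                              | sym (proj₁ (other v (l≢ ∘ sym))) | gap v l≤v v<s | S-other v v≢s =
    trans (+-assoc (p (suc v)) [ S′ v ] 1)
      (trans (cong (p (suc v) +_) (+-comm [ S′ v ] 1)) (sym (+-assoc (p (suc v)) 1 [ S′ v ])))

  out′ : ∀ v → X v ≡ T v ∧ positive (q (suc v))
  out′ v with <-cmp l (suc v)
  ... | tri> _ l≢ v+1<l rewrite boost-below v+1<l | +-identityʳ (p (suc v))
                              | proj₁ (other v (l≢ ∘ sym)) | proj₂ (other v (l≢ ∘ sym)) = out v
  ... | tri≈ _ refl _ rewrite boost-in {suc v} ≤-refl l≤s | proj₁ (picked v refl)
                            | proj₂ (proj₂ (picked v refl)) | +-comm (p (suc v)) 1 = refl
  ... | tri< (s≤s l≤v) l≢ _ with <-≤-connex v s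
  ...   | inj₁ v<s rewrite proj₂ (other v (l≢ ∘ sym)) | out v | sym (proj₁ (other v (l≢ ∘ sym)))
                         | gap v l≤v v<s = refl
  ...   | inj₂ s≤v rewrite boost-above (s≤s s≤v) | +-identityʳ (p (suc v))
                              | proj₁ (other v (l≢ ∘ sym)) | proj₂ (other v (l≢ ∘ sym)) = out v

-- Abstract so that the lists can be recovered by unification.
abstract
  has : List ℕ → NSet
  has xs v = does (v ∈? xs)

  has-intro : ∀ {xs v} → v ∈ xs → has xs v ≡ true
  has-intro {xs} {v} = dec-true (v ∈? xs)

  has-elim : ∀ {xs v} → has xs v ≡ true → v ∈ xs
  has-elim {xs} {v} e with v ∈? xs
  ... | yes v∈ = v∈

has-cong : ∀ {xs ys v} → (v ∈ xs → v ∈ ys) → (v ∈ ys → v ∈ xs) → has xs v ≡ has ys v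
has-cong f g = ≡-from-⇔ (has-intro ∘ f ∘ has-elim) (has-intro ∘ g ∘ has-elim)

has-false : ∀ {xs v} → v ∉ xs → has xs v ≡ false
has-false v∉ = ≡false (v∉ ∘ has-elim)

PickSpec : ℕ → List ℕ → Maybe ℕ → Set
PickSpec s ts nothing  = ∀ u → u ∈ ts → s ≤ u
PickSpec s ts (just t) = t ∈ ts × t < s × (∀ u → u ∈ ts → u < s → u ≤ t)

pickBelow-spec : ∀ s ts → PickSpec s ts (pickBelow s ts)
pickBelow-spec s [] u ()
pickBelow-spec s (t ∷ ts) with pickBelow s ts | pickBelow-spec s ts | t <? s
... | nothing | none | no t≮s = λ { u (here refl) → ≮⇒≥ t≮s ; u (there u∈) → none u u∈ }
... | nothing | none | yes t<s =
  here refl , t<s , λ { u (here refl) _ → ≤-refl ; u (there u∈) u<s → ⊥-elim (<⇒≱ u<s (none u u∈)) }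
... | just w | w∈ , w<s , max | no t≮s =
  there w∈ , w<s , λ { u (here refl) u<s → ⊥-elim (t≮s u<s) ; u (there u∈) u<s → max u u∈ u<s }
... | just w | w∈ , w<s , max | yes t<s with w <? t
...   | yes w<t = here refl , t<s , λ { u (here refl) _ → ≤-refl ; u (there u∈) u<s → ≤-trans (max u u∈ u<s) (<⇒≤ w<t) }
...   | no w≮t = there w∈ , w<s , λ { u (here refl) _ → ≮⇒≥ w≮t ; u (there u∈) u<s → max u u∈ u<s }

removeOne-⊆ : ∀ x ys {v} → v ∈ removeOne x ys → v ∈ ys
removeOne-⊆ x (y ∷ ys) v∈ with x ≟ y
... | yes _ = there v∈
removeOne-⊆ x (y ∷ ys) (here e)   | no _ = here e
removeOne-⊆ x (y ∷ ys) (there v∈) | no _ = there (removeOne-⊆ x ys v∈)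

removeOne-keeps : ∀ x ys {v} → v ≢ x → v ∈ ys → v ∈ removeOne x ys
removeOne-keeps x (y ∷ ys) v≢x v∈ with x ≟ y
... | yes refl = Any.tail v≢x v∈
removeOne-keeps x (y ∷ ys) v≢x (here e)   | no _ = here e
removeOne-keeps x (y ∷ ys) v≢x (there v∈) | no _ = there (removeOne-keeps x ys v≢x v∈)

removeOne-unique : ∀ x ys → Unique ys → Unique (removeOne x ys)
removeOne-unique x [] [] = []
removeOne-unique x (y ∷ ys) (y∉ ∷ u) with x ≟ y
... | yes _ = u
... | no _  = All.tabulate (λ v∈ → All.lookup y∉ (removeOne-⊆ x ys v∈)) ∷ removeOne-unique x ys u

removeOne-drops : ∀ x ys → Unique ys → x ∉ removeOne x ys
removeOne-drops x (y ∷ ys) (y∉ ∷ u) x∈ with x ≟ y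
... | yes refl = All.lookup y∉ x∈ refl
removeOne-drops x (y ∷ ys) (y∉ ∷ u) (here e)   | no x≢y = x≢y e
removeOne-drops x (y ∷ ys) (y∉ ∷ u) (there x∈) | no _   = removeOne-drops x ys u x∈

triGo-⊆ : ∀ ss ts {v} → v ∈ triGo ss ts → v ∈ ts
triGo-⊆ (s ∷ ss) ts v∈ with pickBelow s ts | pickBelow-spec s ts
... | nothing | _ = triGo-⊆ ss ts v∈
triGo-⊆ (s ∷ ss) ts (here refl) | just t | t∈ , _ = t∈
triGo-⊆ (s ∷ ss) ts (there v∈)  | just t | _ = removeOne-⊆ t ts (triGo-⊆ ss (removeOne t ts) v∈)

triGo-unique : ∀ ss ts → Unique ts → Unique (triGo ss ts)
triGo-unique [] ts u = []
triGo-unique (s ∷ ss) ts u with pickBelow s ts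
... | nothing = triGo-unique ss ts u
... | just t  = All.tabulate (λ { v∈ refl → removeOne-drops t ts u (triGo-⊆ ss _ v∈) })
                ∷ triGo-unique ss _ (removeOne-unique t ts u)

Descending : List ℕ → Set
Descending = AllPairs _>_

-- The tail of `ss` is matched against the list without the pick of `s`, and `Match-insert` adds the
-- request `s` back. Its gap condition is the maximality of the pick.
triGo-Match : ∀ ss ts → Descending ss → Unique ts → Match (has ts) (has ss) (has (triGo ss ts))
triGo-Match [] ts _ u = match (λ _ → 0) 0 (λ _ _ → refl)
    (λ v → sym (cong₂ _+_ (0∸n≡0 [ has ts v ]) (cong [_] (empty v))))
    (λ v → trans (empty v) (sym (∧-zeroʳ (has ts v))))
  where
  empty : ∀ v → has [] v ≡ false
  empty v = has-false λ ()
triGo-Match (s ∷ ss) ts (s> ∷ desc) u with pickBelow s ts | pickBelow-spec s ts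
... | nothing | none = Match-insert (triGo-Match ss ts desc u) 0 s z≤n
  (has-intro (here refl)) (λ v v≢s → has-cong (λ v∈ → Any.tail v≢s v∈) there)
  (λ v s≤v → has-false (λ v∈ → <⇒≱ (All.lookup s> v∈) s≤v))
  (λ _ ()) (λ _ _ → refl , refl)
  (λ v _ v<s → has-false (λ v∈ → <⇒≱ v<s (none v v∈)))
... | just t | t∈ , t<s , max = Match-insert (triGo-Match ss (removeOne t ts) desc (removeOne-unique t ts u)) (suc t) s t<s
  (has-intro (here refl)) (λ v v≢s → has-cong (λ v∈ → Any.tail v≢s v∈) there)
  (λ v s≤v → has-false (λ v∈ → <⇒≱ (All.lookup s> v∈) s≤v))
  (λ { v refl → has-intro t∈ , has-false (removeOne-drops t ts u) , has-intro (here refl) })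
  (λ v v+1≢ → has-cong (removeOne-keeps t ts (v+1≢ ∘ cong suc)) (removeOne-⊆ t ts) ,
              has-cong (λ v∈ → Any.tail (v+1≢ ∘ cong suc) v∈) there)
  (λ v t<v v<s → has-false (λ v∈ → <⇒≱ t<v (max v v∈ v<s)))

insertDesc-⊆ : ∀ x ys {v} → v ∈ insertDesc x ys → v ∈ x ∷ ys
insertDesc-⊆ x [] v∈ = v∈
insertDesc-⊆ x (y ∷ ys) v∈ with y <? x
... | yes _ = v∈
insertDesc-⊆ x (y ∷ ys) (here e) | no _ = there (here e)
insertDesc-⊆ x (y ∷ ys) (there v∈) | no _ with insertDesc-⊆ x ys v∈
... | here e   = here e
... | there v∈′ = there (there v∈′)

insertDesc-⊇ : ∀ x ys {v} → v ∈ x ∷ ys → v ∈ insertDesc x ys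
insertDesc-⊇ x [] v∈ = v∈
insertDesc-⊇ x (y ∷ ys) v∈ with y <? x
... | yes _ = v∈
insertDesc-⊇ x (y ∷ ys) (here e)           | no _ = there (insertDesc-⊇ x ys (here e))
insertDesc-⊇ x (y ∷ ys) (there (here e))   | no _ = here e
insertDesc-⊇ x (y ∷ ys) (there (there v∈)) | no _ = there (insertDesc-⊇ x ys (there v∈))

insertDesc-descending : ∀ x ys → x ∉ ys → Descending ys → Descending (insertDesc x ys)
insertDesc-descending x [] _ _ = [] ∷ []
insertDesc-descending x (y ∷ ys) x∉ d@(y> ∷ dys) with y <? x
... | yes y<x = (y<x ∷ All.map (λ z<y → <-trans z<y y<x) y>) ∷ d
... | no y≮x = All.tabulate below-y ∷ insertDesc-descending x ys (x∉ ∘ there) dys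
  where
  below-y : ∀ {v} → v ∈ insertDesc x ys → y > v
  below-y v∈ with insertDesc-⊆ x ys v∈
  ... | here refl  = ≤∧≢⇒< (≮⇒≥ y≮x) (λ e → x∉ (here e))
  ... | there v∈ys = All.lookup y> v∈ys

sortDesc-⊆ : ∀ xs {v} → v ∈ sortDesc xs → v ∈ xs
sortDesc-⊆ (x ∷ xs) v∈ with insertDesc-⊆ x (sortDesc xs) v∈
... | here e    = here e
... | there v∈′ = there (sortDesc-⊆ xs v∈′)

sortDesc-⊇ : ∀ xs {v} → v ∈ xs → v ∈ sortDesc xs
sortDesc-⊇ (x ∷ xs) (here e)   = insertDesc-⊇ x (sortDesc xs) (here e)
sortDesc-⊇ (x ∷ xs) (there v∈) = insertDesc-⊇ x (sortDesc xs) (there (sortDesc-⊇ xs v∈))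

sortDesc-descending : ∀ xs → Unique xs → Descending (sortDesc xs)
sortDesc-descending [] [] = []
sortDesc-descending (x ∷ xs) (x∉ ∷ u) = insertDesc-descending x (sortDesc xs)
  (λ x∈ → All.lookup x∉ (sortDesc-⊆ xs x∈) refl) (sortDesc-descending xs u)

◁-unique : ∀ T S → Unique T → Unique (T ◁ S)
◁-unique T S = triGo-unique (sortDesc S) T

◁-Match : ∀ T S → Unique T → Unique S → Match (has T) (has S) (has (T ◁ S))
◁-Match T S uT uS = Match-cong (λ _ → refl)
  (λ v → has-cong (sortDesc-⊆ S) (sortDesc-⊇ S)) (λ _ → refl)
  (triGo-Match (sortDesc S) T (sortDesc-descending S uS) uT)

-- A general `f` is needed since removing the first column turns `f` into `f ∘ suc`. Uniqueness
-- travels along because the result becomes the right argument of the next `◁`.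
◁-iter-Chain : (L : ℕ → List ℕ) → (∀ c → Unique (L c)) → ∀ k j f → (∀ i → f i ≡ j + i) →
  let X = ◁-iter (map L (applyUpTo f (suc k))) in Chain (has ∘ L) j k (has X) × Unique X
◁-iter-Chain L u zero j f fi rewrite fi 0 | +-identityʳ j = (λ _ → refl) , u j
◁-iter-Chain L u (suc k) j f fi
  with ◁-iter-Chain L u k (suc j) (f ∘ suc) (λ i → trans (fi (suc i)) (+-suc j i))
... | ch , uY rewrite fi 0 | +-identityʳ j = (_ , ch , ◁-Match (L j) Y (u j) uY) , ◁-unique (L j) Y (u j)
  where Y = ◁-iter (map L (applyUpTo (f ∘ suc) (suc k)))

-- Anti-rectification

numEntry-elim : ∀ {x v} → v ∈ numEntry x → x ≡ just (num v)
numEntry-elim {just (num n)} (here refl) = refl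

numEntry-intro : ∀ {x v} → x ≡ just (num v) → v ∈ numEntry x
numEntry-intro refl = here refl

numEntry-unique : ∀ x → Unique (numEntry x)
numEntry-unique nothing        = AllPairs.[]
numEntry-unique (just dot)     = AllPairs.[]
numEntry-unique (just (num n)) = All.[] AllPairs.∷ AllPairs.[]

colEntries-elim : ∀ F K c {v} → v ∈ colEntries F K c → ∃[ r ] (F r c ≡ just (num v))
colEntries-elim F K c v∈ with find (∈-concatMap⁻ (λ r → numEntry (F r c)) {xs = upTo K} v∈)
... | r , _ , v∈r = r , numEntry-elim v∈r

colEntries-intro : ∀ {K F} → RowBound K F → ∀ {r c v} → F r c ≡ just (num v) → v ∈ colEntries F K c
colEntries-intro bd e = ∈-concatMap⁺ _ (lose (∈-upTo⁺ (row-inside bd e)) (numEntry-intro e))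

colEntries-unique : ∀ {m F} → IncreasingAt m F → ∀ K c → Unique (colEntries F K c)
colEntries-unique {F = F} inc K c = Unique.concat⁺
  (All.map⁺ (All.universal (λ r → numEntry-unique (F r c)) (upTo K)))
  (AllPairs.map⁺ (AllPairs.map
    (λ r≢r′ {_} (v∈ , v∈′) → r≢r′ (column-functional inc (numEntry-elim v∈) (numEntry-elim v∈′)))
    (Unique.upTo⁺ K)))

NoneBeyond : ℕ → Filling → Set
NoneBeyond C F = ∀ r c n → C ≤ c → F r c ≢ just (num n)

Chain-ext : ∀ {a X X′} j k → X ≗ X′ → Chain a j k X → Chain a j k X′
Chain-ext j zero    e X≐ v = trans (sym (e v)) (X≐ v)
Chain-ext j (suc k) e (Y , ch , M) = Y , ch , Match-cong (λ _ → refl) (λ _ → refl) e M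

revKjdtAll-bound : ∀ M {K F} → RowBound K F → RowBound K (revKjdtAll M F)
revKjdtAll-bound zero    bd = bd
revKjdtAll-bound (suc m) {F = F} bd =
  revKjdtAll-bound m (λ r c K≤r → revKjdt-nothing (suc m) F (bd r c K≤r))

-- Two facts travel in opposite directions. `NoneBeyond` is given after the last slide and is passed
-- back; each slide then needs it to push the chain forward. Hence a single induction proves both.
revKjdtAll-Chain : ∀ M {F K} → IsSInc M F → RowBound K F → ∀ k →
  NoneBeyond (suc k) (revKjdtAll M F) →
  NoneBeyond (suc k) F ×
  (∀ {X} → Chain (column K F) 0 k X → Chain (column K (revKjdtAll M F)) 0 k X)
revKjdtAll-Chain zero    S bd k none = none , λ ch → ch
revKjdtAll-Chain (suc m) {F} {K} S bd k none = none-F , chain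
  where
  open Step S bd using (bd′; num-beyond; Chain-step; first-column-fixed)
  rec = revKjdtAll-Chain m (revKjdt-sInc m F S) bd′ k none
  none-F : NoneBeyond (suc k) F
  none-F r c n C≤c e with num-beyond (suc k) r c n C≤c e
  ... | r′ , c′ , n′ , C≤c′ , e′ = proj₁ rec r′ c′ n′ C≤c′ e′
  chain : ∀ {X} → Chain (column K F) 0 k X → Chain (column K (revKjdtAll m (revKjdt (suc m) F))) 0 k X
  chain ch with Chain-step (suc k) (proj₁ rec) k 0 refl ch
  ... | X′ , ch′ , rel = proj₂ rec (Chain-ext 0 k (λ v → sym (first-column-fixed rel v)) ch′)

deleteDots-elim : ∀ F {r c n} → deleteDots F r c ≡ just (num n) → F r c ≡ just (num n)
deleteDots-elim F {r} {c} e with F r c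
... | just (num n) = e

deleteDots-intro : ∀ F {r c n} → F r c ≡ just (num n) → deleteDots F r c ≡ just (num n)
deleteDots-intro F {r} {c} e with F r c
... | just (num n) = e

deleteDots-nothing : ∀ F {r c} → F r c ≡ nothing → deleteDots F r c ≡ nothing
deleteDots-nothing F {r} {c} e with F r c
... | nothing = refl

part-beyond : ∀ lam {r} → length lam ≤ r → part lam r ≡ 0
part-beyond []        _         = refl
part-beyond (x ∷ lam) (s≤s l≤r) = part-beyond lam l≤r

shape-bound : ∀ {F} lam mu → HasShape F lam mu → RowBound (length lam) F
shape-bound {F} lam mu sh r c l≤r with F r c in eq
... | nothing = refl
... | just e with subst (c <_) (part-beyond lam l≤r) (proj₂ (Equivalence.from (sh r c) (e , eq)))
...   | ()

-- Tableaux of anti-normal shape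

module AntiNormal {C R : ℕ} {nu : List ℕ} {Q : Filling}
    (cells : ∀ r c → AntiCell R C nu r c ⇔ Occupied Q r c) (inc : IsIncreasing Q) where

  cell : ∀ {r c e} → Q r c ≡ just e → AntiCell R C nu r c
  cell {r} {c} e = Equivalence.from (cells r c) (_ , e)

  no-dots : ∀ {r c} → Q r c ≢ just dot
  no-dots {r} {c} = proj₁ inc r c

  increasing : IncreasingAt 0 Q
  increasing = proj₂ (proj₂ inc)

  rows-bounded : RowBound R Q
  rows-bounded r c R≤r with Q r c in eq
  ... | nothing = refl
  ... | just e  = ⊥-elim (<⇒≱ (proj₁ (cell eq)) R≤r)

  none-beyond : NoneBeyond C Q
  none-beyond r c n C≤c e = <⇒≱ (proj₁ (proj₂ (cell e))) C≤c

  right-occupied : ∀ {r c e} → suc c < C → Q r c ≡ just e → Occupied Q r (suc c)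
  right-occupied {r} {c} c+1<C e with cell e
  ... | r<R , _ , _ , in-nu = Equivalence.to (cells r (suc c))
    (r<R , c+1<C , z≤n , ≤-<-trans (∸-monoʳ-≤ C (n≤1+n (suc c))) in-nu)

  -- Missing cells count as before every value: among the first `R` rows, a column of an anti-normal
  -- shape lacks only cells above its entries.
  A : ℕ → ℕ → ℕ
  A c = rowsBefore R (λ _ → true) 0 Q c

  A-suc : ∀ c v → A c (suc v) ≡ A c v + [ column R Q c v ]
  A-suc c v = rowsBefore-suc R (λ _ → true) 0 increasing c v (λ r e → ⊥-elim (no-dots e))

  A-shift : ∀ c v → suc c < C → A (suc c) (suc v) ≤ A c v
  A-shift c v c+1<C = count-mono R at
    where
    at : ∀ r → before true 0 (suc v) (Q r (suc c)) ≡ true → before true 0 v (Q r c) ≡ true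
    at r b with Q r c in eq
    ... | nothing  = refl
    ... | just dot = ⊥-elim (no-dots eq)
    ... | just (num k) with right-occupied c+1<C eq
    ...   | dot , eq′ = ⊥-elim (no-dots eq′)
    ...   | num n , eq′ rewrite eq′ = <ᵇ-true (<-≤-trans
              (proj₁ increasing r c (suc c) _ _ ≤-refl eq eq′) (≤-pred (<ᵇ-elim {n} b)))

  A-top : ∀ c c′ v → (∀ w → v ≤ w → column R Q c′ w ≡ false) → A c v ≤ A c′ v
  A-top c c′ v bound = count-mono R (λ r _ → at r)
    where
    at : ∀ r → before true 0 v (Q r c′) ≡ true
    at r with Q r c′ in eq
    ... | nothing  = refl
    ... | just dot = ⊥-elim (no-dots eq)
    ... | just (num n) with <-≤-connex n v
    ...   | inj₁ n<v = <ᵇ-true n<v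
    ...   | inj₂ v≤n = ⊥-elim (false≢true (bound n v≤n) (column-intro rows-bounded eq))

  -- Every row of column c continues into column c + 1, so nothing goes unpicked.
  Chain-column : ∀ k c {X} → suc (c + k) ≡ C → Chain (column R Q) c k X → X ≗ column R Q c
  Chain-column zero    c eq X≐ = X≐
  Chain-column (suc k) c {X} eq (Y , ch , M) v = trans (out v) (absorb (column R Q c v) refl)
    where
    open Match M
    c+1<C : suc c < C
    c+1<C = subst (suc c <_) eq (s≤s (≤-trans (s≤s (m≤m+n c k)) (≤-reflexive (sym (+-suc c k)))))
    Y≐ : Y ≗ column R Q (suc c)
    Y≐ = Chain-column k (suc c) (trans (cong suc (sym (+-suc c k))) eq) ch
    N = proj₁ (column-bounded R Q (suc c))

    saturated : ∀ v → A c v ≤ p v + A (suc c) v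
    -- Beyond all entries of column `suc c` its count is the full number of rows `R`, so saturation
    -- holds there.
    saturated v = descend (λ v → A c v ≤ p v + A (suc c) v) (N ⊔ top) 0
      (λ v _ N≤v → ≤-trans (A-top c (suc c) v (λ w v≤w → proj₂ (column-bounded R Q (suc c)) w
                               (≤-trans (≤-trans (m≤m⊔n N top) N≤v) v≤w)))
                           (m≤n+m (A (suc c) v) (p v)))
      (λ v _ → pending-saturated M (A c) (A (suc c)) v (≤-reflexive (sym (A-suc c v)))
         (≤-reflexive (trans (A-suc (suc c) v) (cong (λ d → A (suc c) v + [ d ]) (sym (Y≐ v))))))
      v z≤n

    absorb : ∀ t → column R Q c v ≡ t → column R Q c v ∧ positive (p (suc v)) ≡ column R Q c v
    absorb false e rewrite e = refl
    absorb true  e = trans (cong (column R Q c v ∧_)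
      (pending-positive M (A c) (A (suc c)) v (≤-reflexive (sym (A-suc c v))) (A-shift c v c+1<C)
         (saturated (suc v)) e)) (trans (cong (_∧ true) e) (sym e))

-- Placing and deleting bullets leaves the number sets of all columns alone, so only the slides
-- matter. The row bound `K` is arbitrary because each step comes with a shape, hence a bound, of
-- its own.
AntiRect-Chain : ∀ {T Q} k → AntiRect T Q → IsAntiNormalWidth (suc k) Q → IsIncreasing Q →
  ∀ {K} → RowBound K T → NoneBeyond (suc k) T ×
  (∀ {X} → Chain (column K T) 0 k X → ∀ n → X n ≡ true ⇔ (∃[ r ] (Q r 0 ≡ just (num n))))
AntiRect-Chain {T} k (done _) (R , nu , _ , cells) inc {K} bd = none-beyond , first
  where
  open AntiNormal {nu = nu} cells inc
  first : ∀ {X} → Chain (column K T) 0 k X → ∀ n → X n ≡ true ⇔ (∃[ r ] (T r 0 ≡ just (num n)))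
  first ch n = mk⇔ (λ Xn → column-elim rows-bounded (trans (sym (X≐ n)) Xn))
                   (λ (_ , e) → trans (X≐ n) (column-intro rows-bounded e))
    where X≐ = Chain-column k 0 refl (Chain-cong 0 k
                 (λ c v → column-cong bd rows-bounded (λ r e → r , e) (λ r e → r , e)) ch)
AntiRect-Chain {T} {Q} k (step {T' = T′} _ (M , D , _ , _ , place , S , T′≡) rest) anti inc {K} bd =
    none-T , λ ch → proj₂ rec (Chain-cong 0 k D≐T′ (proj₂ slide (Chain-cong 0 k T≐D ch)))
  where
  K′ = length (proj₁ (proj₁ S))
  D-bound : RowBound K′ D
  D-bound = shape-bound (SIncLemmas.lam S) (SIncLemmas.mu S) (SIncLemmas.shape S)
  E = revKjdtAll M D
  E-bound : RowBound K′ E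
  E-bound = revKjdtAll-bound M D-bound
  T′-bound : RowBound K′ T′
  T′-bound r c K≤r = trans (T′≡ r c) (deleteDots-nothing E (E-bound r c K≤r))
  rec = AntiRect-Chain k rest anti inc T′-bound

  E→T′ : ∀ {r c n} → E r c ≡ just (num n) → T′ r c ≡ just (num n)
  E→T′ e = trans (T′≡ _ _) (deleteDots-intro E e)
  T′→E : ∀ {r c n} → T′ r c ≡ just (num n) → E r c ≡ just (num n)
  T′→E e = deleteDots-elim E (trans (sym (T′≡ _ _)) e)
  slide = revKjdtAll-Chain M S D-bound k (λ r c n C≤c e → proj₁ rec r c n C≤c (E→T′ e))

  T→D : ∀ {r c n} → T r c ≡ just (num n) → D r c ≡ just (num n)
  T→D {r} {c} e with place r c
  ... | inj₁ D≡T = trans D≡T e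
  ... | inj₂ (T≡ , _) with trans (sym T≡) e
  ...   | ()
  D→T : ∀ {r c n} → D r c ≡ just (num n) → T r c ≡ just (num n)
  D→T {r} {c} e with place r c
  ... | inj₁ D≡T = trans (sym D≡T) e
  ... | inj₂ (_ , D≡) with trans (sym D≡) e
  ...   | ()

  none-T : NoneBeyond (suc k) T
  none-T r c n C≤c e = proj₁ slide r c n C≤c (T→D e)
  T≐D : ∀ c → column K T c ≗ column K′ D c
  T≐D c v = column-cong bd D-bound (λ r e → r , T→D e) (λ r e → r , D→T e)
  D≐T′ : ∀ c → column K′ E c ≗ column K′ T′ c
  D≐T′ c v = column-cong E-bound T′-bound (λ r e → r , E→T′ e) (λ r e → r , T′→E e)

AntiRect-first-column : ∀ {P Q K} → RowBound K P → IsIncreasing P → IsIncreasing Q →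
  AntiRect P Q → ∀ C → IsAntiNormalWidth C Q →
  ∀ n → (∃[ r ] (Q r 0 ≡ just (num n))) ⇔ (n ∈ ◁-iter (map (colEntries P K) (upTo C)))
AntiRect-first-column bd incP incQ ar zero (R , nu , _ , cells) n = mk⇔ empty (λ ())
  where
  empty : ∃[ r ] (_ ≡ just (num n)) → n ∈ []
  empty (r , e) with Equivalence.from (cells r 0) (_ , e)
  ... | _ , () , _
AntiRect-first-column {P} {Q} {K} bd incP incQ ar (suc k) anti n =
    mk⇔ (has-elim ∘ Equivalence.from first) (Equivalence.to first ∘ has-intro)
  where
  L = colEntries P K
  chain = proj₁ (◁-iter-Chain L (colEntries-unique (proj₂ (proj₂ incP)) K) k 0 (λ i → i) (λ _ → refl))
  L≐column : ∀ c v → has (L c) v ≡ column K P c v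
  L≐column c v = ≡-from-⇔ (column-intro bd ∘ proj₂ ∘ colEntries-elim P K c ∘ has-elim)
                          (has-intro ∘ colEntries-intro bd ∘ proj₂ ∘ column-elim bd)
  first = proj₂ (AntiRect-Chain k ar anti incQ bd) (Chain-cong 0 k L≐column chain) n

theorem5p9 : (P Q : Filling) (lam : List ℕ)
    → IsPartition lam
    → HasShape P lam []
    → IsIncreasing P
    → IsIncreasing Q
    → IsAntiNormalWidth (part lam 0) Q
    → AntiRect P Q
    → ∀ n → (∃[ r ] (Q r 0 ≡ just (num n))) ⇔ (n ∈ ◁-iter (columnSets P lam))
theorem5p9 P Q lam _ shape incP incQ anti ar =
  AntiRect-first-column (shape-bound lam [] shape) incP incQ ar (part lam 0) anti
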